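{- Let $d\ge 1$, let $n_1,\ldots,n_d$ be positive integers, and let $G=P_{n_1}\square\cdots\square P_{n_d}$. If at least three of $n_1,\ldots,n_d$ are at least $3$ (that is, at least three indices $i$ satisfy $n_i\ge 3$), then $G$ is not a PCG. In particular, $P_a\square P_b\square P_c$ is not a PCG whenever $a,b,c\ge 3$.
   Context: All graphs are finite, simple, and undirected. A weighted tree is a finite tree with strictly positive real edge weights. For a weighted tree $T$ and vertices $x,y$ of $T$, $d_T(x,y)$ is the total weight of the unique $x$–$y$ path, and $L(T)$ is the set of leaves of $T$. Grid graph: for positive integers $n_1,\ldots,n_d$, the graph $P_{n_1}\square\cdots\square P_{n_d}$ has vertex set $\{(x_1,\ldots,x_d)\in\mathbb{Z}^d: 0\le x_i\le n_i-1 \text{ for every } i\in\{1,\ldots,d\}\}$; two vertices are adjacent if and only if they differ by $1$ in exactly one coordinate and agree in every other coordinate. PCG (pairwise compatibility graph): a graph $G=(V,E)$ is a PCG if there exist a weighted tree $T$, a bijection $\zeta:V\to L(T)$, and real numbers $0\le d_{\min}\le d_{\max}$ such that for every pair of distinct vertices $u,v\in V$, $uv\in E$ if and only if $d_{\min}\le d_T(\zeta(u),\zeta(v))\le d_{\max}$. -}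

module Defs where

open import Data.Fin.Base using (Fin; zero; suc; toℕ)
open import Data.Fin.Properties using (*↔×)
open import Data.List.Base using (List; []; _∷_)
open import Data.List.Relation.Unary.Unique.Propositional using (Unique)
open import Data.Nat.Base as ℕ using (ℕ; ∣_-_∣)
import Data.Nat.Properties as ℕ
open import Data.Product.Base using (Σ; ∃; _×_; _,_; proj₁; proj₂)
open import Data.Product using (∃!)
open import Data.Product.Function.NonDependent.Propositional using (_×-↔_)
open import Data.Rational.Base as ℚ using (ℚ; 0ℚ; ½)
import Data.Rational.Properties as ℚ
open import Data.Rational.Solver using (module +-*-Solver)
open import Data.Vec.Base using (Vec; []; _∷_; lookup)
open import Data.Vec.Relation.Unary.All using (All; []; _∷_)
open import Data.Vec.Relation.Unary.All.Properties using (lookup⁺)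
open import Function.Base using (_on_)
open import Function.Bundles using (_↔_; _⇔_; mk↔ₛ′; Bijection)
open import Function.Properties.Inverse using (↔-refl; ↔-sym; ↔-trans)
open import Level using (0ℓ)
open import Relation.Binary.Bundles using (Setoid)
open import Relation.Binary.Construct.Closure.ReflexiveTransitive using (Star; ε; _◅_)
import Relation.Binary.Construct.On as On
open import Relation.Binary.PropositionalEquality
  using (_≡_; _≢_; refl; sym; trans; cong; setoid)
open import Relation.Nullary.Negation using (¬_)

------------------------------------------------------------------------
-- Real numbers as Cauchy sequences of rationals.  Two sequences denote the
-- same real number when they are related by _≃_.

IsCauchy : (ℕ → ℚ) → Set
IsCauchy x = ∀ δ → 0ℚ ℚ.< δ →
  ∃ λ N → ∀ m n → N ℕ.≤ m → N ℕ.≤ n → ℚ.∣ x m ℚ.- x n ∣ ℚ.< δ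

record ℝ : Set where
  constructor mkℝ
  field
    seq    : ℕ → ℚ
    cauchy : IsCauchy seq

open ℝ public

private
  0<½δ : ∀ δ → 0ℚ ℚ.< δ → 0ℚ ℚ.< ½ ℚ.* δ
  0<½δ δ 0<δ = ℚ.<-respˡ-≡ (ℚ.*-zeroʳ ½) (ℚ.*-monoʳ-<-pos ½ 0<δ)

  ½δ+½δ≡δ : ∀ δ → ½ ℚ.* δ ℚ.+ ½ ℚ.* δ ≡ δ
  ½δ+½δ≡δ δ = trans (sym (ℚ.*-distribʳ-+ δ ½ ½)) (ℚ.*-identityˡ δ)

  interchange : ∀ a b c d →
    (a ℚ.+ b) ℚ.- (c ℚ.+ d) ≡ (a ℚ.- c) ℚ.+ (b ℚ.- d)
  interchange = solve 4
    (λ a b c d → (a :+ b) :- (c :+ d) := (a :- c) :+ (b :- d)) refl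
    where open +-*-Solver

  const-cauchy : ∀ q → IsCauchy (λ _ → q)
  const-cauchy q δ 0<δ =
    0 , λ _ _ _ _ → ℚ.<-respˡ-≡ (cong ℚ.∣_∣ (sym (ℚ.+-inverseʳ q))) 0<δ

  +-cauchy : ∀ x y → IsCauchy x → IsCauchy y → IsCauchy (λ n → x n ℚ.+ y n)
  +-cauchy x y cx cy δ 0<δ
    with cx (½ ℚ.* δ) (0<½δ δ 0<δ) | cy (½ ℚ.* δ) (0<½δ δ 0<δ)
  ... | M , p | N , q = M ℕ.⊔ N , λ m n m≥ n≥ → begin-strict
    ℚ.∣ (x m ℚ.+ y m) ℚ.- (x n ℚ.+ y n) ∣
      ≡⟨ cong ℚ.∣_∣ (interchange (x m) (y m) (x n) (y n)) ⟩
    ℚ.∣ (x m ℚ.- x n) ℚ.+ (y m ℚ.- y n) ∣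
      ≤⟨ ℚ.∣p+q∣≤∣p∣+∣q∣ (x m ℚ.- x n) (y m ℚ.- y n) ⟩
    ℚ.∣ x m ℚ.- x n ∣ ℚ.+ ℚ.∣ y m ℚ.- y n ∣
      <⟨ ℚ.+-mono-<
           (p m n (ℕ.m⊔n≤o⇒m≤o M N m≥) (ℕ.m⊔n≤o⇒m≤o M N n≥))
           (q m n (ℕ.m⊔n≤o⇒n≤o M N m≥) (ℕ.m⊔n≤o⇒n≤o M N n≥)) ⟩
    ½ ℚ.* δ ℚ.+ ½ ℚ.* δ
      ≡⟨ ½δ+½δ≡δ δ ⟩
    δ ∎
    where open ℚ.≤-Reasoning

0ℝ : ℝ
0ℝ = mkℝ (λ _ → 0ℚ) (const-cauchy 0ℚ)

infixl 6 _+_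
infix  4 _<_ _≤_ _≃_

_+_ : ℝ → ℝ → ℝ
x + y = mkℝ (λ n → seq x n ℚ.+ seq y n) (+-cauchy (seq x) (seq y) (cauchy x) (cauchy y))

-- The gap δ must be uniform: the termwise inequality alone is not invariant
-- under _≃_.
_<_ : ℝ → ℝ → Set
x < y = ∃ λ δ → 0ℚ ℚ.< δ ×
  ∃ λ N → ∀ n → N ℕ.≤ n → seq x n ℚ.+ δ ℚ.≤ seq y n

_≤_ : ℝ → ℝ → Set
x ≤ y = ¬ (y < x)

_≃_ : ℝ → ℝ → Set
x ≃ y = x ≤ y × y ≤ x

------------------------------------------------------------------------
-- Finite simple graphs

record Graph : Set₁ where
  infix 4 _~_
  field
    Vertex   : Set
    order    : ℕ
    finite   : Vertex ↔ Fin order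
    _~_      : Vertex → Vertex → Set
    ~-sym    : ∀ {x y} → x ~ y → y ~ x
    ~-irrefl : ∀ {x} → ¬ (x ~ x)

  Walk : Vertex → Vertex → Set
  Walk = Star _~_

  vertices : ∀ {x y} → Walk x y → List Vertex
  vertices {x} ε       = x ∷ []
  vertices {x} (_ ◅ w) = x ∷ vertices w

  IsPath : ∀ {x y} → Walk x y → Set
  IsPath w = Unique (vertices w)

  -- In a simple graph a walk is determined by its sequence of vertices; the
  -- witnesses of adjacency it carries are immaterial.
  _≈ʷ_ : ∀ {x y} → Walk x y → Walk x y → Set
  v ≈ʷ w = vertices v ≡ vertices w

  -- A vertex of degree one.
  IsLeaf : Vertex → Set
  IsLeaf x = ∃! _≡_ (λ y → x ~ y)

  -- Two leaves are equal when they are the same vertex.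
  Leaves : Setoid 0ℓ 0ℓ
  Leaves = record
    { Carrier       = ∃ IsLeaf
    ; _≈_           = _≡_ on proj₁
    ; isEquivalence = On.isEquivalence proj₁ (Setoid.isEquivalence (setoid Vertex))
    }

-- A tree is a nonempty graph in which any two vertices are joined by exactly
-- one path.
record IsTree (G : Graph) : Set where
  open Graph G
  field
    nonempty   : Vertex
    uniquePath : ∀ x y → ∃! (_≈ʷ_ {x} {y}) IsPath

  path : ∀ x y → Walk x y
  path x y = proj₁ (uniquePath x y)

record WeightedTree : Set₁ where
  field
    graph  : Graph
    isTree : IsTree graph
  open Graph graph public
  open IsTree isTree public
  field
    -- Irrelevance makes the weight a function of the ends of the edge; by
    -- weight-sym it does not depend on their order either.
    weight     : ∀ x y → .(x ~ y) → ℝ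
    weight-sym : ∀ {x y} (e : x ~ y) → weight x y e ≃ weight y x (~-sym e)
    weight-pos : ∀ {x y} (e : x ~ y) → 0ℝ < weight x y e

  walkWeight : ∀ {x y} → Walk x y → ℝ
  walkWeight ε                   = 0ℝ
  walkWeight (_◅_ {x} {y} e w) = weight x y e + walkWeight w

  dist : Vertex → Vertex → ℝ
  dist x y = walkWeight (path x y)

------------------------------------------------------------------------
-- Pairwise compatibility graphs

record PCG (G : Graph) : Set₁ where
  open Graph G using (Vertex; _~_)
  field
    tree : WeightedTree
  open WeightedTree tree using (Leaves; dist)
  field
    ζ         : Bijection (setoid Vertex) Leaves
    dmin dmax : ℝ
    0≤dmin    : 0ℝ ≤ dmin
    dmin≤dmax : dmin ≤ dmax

  distance : Vertex → Vertex → ℝ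
  distance u v = dist (proj₁ (Bijection.to ζ u)) (proj₁ (Bijection.to ζ v))

  field
    compatible : ∀ u v → u ≢ v →
      u ~ v ⇔ (dmin ≤ distance u v × distance u v ≤ dmax)

------------------------------------------------------------------------
-- Grid graphs

-- The i-th entry of a grid point lies in Fin nᵢ, that is, in {0, …, nᵢ - 1}.
GridPoint : ∀ {d} → Vec ℕ d → Set
GridPoint = All Fin

coord : ∀ {d} {ns : Vec ℕ d} → GridPoint ns → (i : Fin d) → Fin (lookup ns i)
coord = lookup⁺

GridAdj : ∀ {d} {ns : Vec ℕ d} → GridPoint ns → GridPoint ns → Set
GridAdj {d} u v = Σ (Fin d) λ i →
  ∣ toℕ (coord u i) - toℕ (coord v i) ∣ ≡ 1 ×
  (∀ j → j ≢ i → coord u j ≡ coord v j)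

private
  size : ∀ {d} → Vec ℕ d → ℕ
  size []       = 1
  size (n ∷ ns) = n ℕ.* size ns

  []↔Fin1 : GridPoint [] ↔ Fin 1
  []↔Fin1 = mk↔ₛ′ (λ _ → zero) (λ _ → []) (λ { zero → refl ; (suc ()) }) (λ { [] → refl })

  ∷↔× : ∀ {d n} {ns : Vec ℕ d} → GridPoint (n ∷ ns) ↔ (Fin n × GridPoint ns)
  ∷↔× = mk↔ₛ′ (λ { (x ∷ xs) → x , xs }) (λ { (x , xs) → x ∷ xs })
              (λ _ → refl) (λ { (_ ∷ _) → refl })

  grid-finite : ∀ {d} (ns : Vec ℕ d) → GridPoint ns ↔ Fin (size ns)
  grid-finite []       = []↔Fin1
  grid-finite (n ∷ ns) =
    ↔-trans ∷↔× (↔-trans (↔-refl ×-↔ grid-finite ns) (↔-sym *↔×))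

  grid-sym : ∀ {d} {ns : Vec ℕ d} {u v : GridPoint ns} → GridAdj u v → GridAdj v u
  grid-sym {u = u} {v} (i , p , q) =
    i , trans (ℕ.∣-∣-comm (toℕ (coord v i)) (toℕ (coord u i))) p
      , λ j j≢i → sym (q j j≢i)

  grid-irrefl : ∀ {d} {ns : Vec ℕ d} {u : GridPoint ns} → ¬ GridAdj u u
  grid-irrefl {u = u} (i , p , _)
    with () ← trans (sym (ℕ.∣n-n∣≡0 (toℕ (coord u i)))) p

Grid : ∀ {d} → Vec ℕ d → Graph
Grid ns = record
  { Vertex   = GridPoint ns
  ; order    = size ns
  ; finite   = grid-finite ns
  ; _~_      = GridAdj
  ; ~-sym    = λ {u} {v} → grid-sym {u = u} {v}
  ; ~-irrefl = λ {u} → grid-irrefl {u = u}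
  }

{-# OPTIONS --safe #-}
module Submission where

-- Leaf-to-leaf distances in a tree satisfy the four-point condition, hence also
-- its 3 × 3 analogue: among the six sums D a₁ b_σ₁ + D a₂ b_σ₂ + D a₃ b_σ₃ the
-- largest value is attained twice.  In a representation of a graph as a PCG
-- every distance between distinct vertices is short (below dmin), medium (an
-- edge) or long (above dmax), so this forbids certain patterns of short and long
-- distances.  A grid with three sides of length at least 3 contains the
-- 3 × 3 × 3 cube as an induced subgraph, and for the cube the patterns admit no
-- consistent choice; the case analysis showing this, which exploits the 48
-- symmetries of the cube, was found by a computer search.

open import Defs using (PCG; Grid)
open import Data.Fin.Base using (Fin)
open import Data.Nat.Base using (ℕ; _≤_)
open import Data.Nat.Properties using (_≤?_)
open import Data.Product.Base using (_×_)
open import Data.Vec.Base using (Vec; []; _∷_; lookup; count)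
open import Relation.Nullary.Negation using (¬_)

open import Defs as ℝ using (ℝ; seq; Graph; IsTree; WeightedTree; GridPoint; GridAdj; coord)
open import Data.Bool.Base using (Bool; true; false; T; _∧_; _∨_; if_then_else_)
open import Data.Bool.Properties using (T-∧; T-∨)
open import Data.Empty using (⊥; ⊥-elim)
open import Data.Fin.Base using (zero; suc; toℕ; opposite; inject≤; fromℕ<)
import Data.Fin.Properties as Fin
import Data.Integer.Base as ℤ
open import Data.List.Base using (List; []; _∷_; map; _∷ʳ_)
open import Data.List.Membership.Propositional using (_∈_)
open import Data.List.Properties using (∷-injectiveˡ; ∷-injectiveʳ)
open import Data.List.Relation.Unary.All as All using (All; []; _∷_)
import Data.List.Relation.Unary.All.Properties as All
open import Data.List.Relation.Unary.AllPairs using ([]; _∷_)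
open import Data.List.Relation.Unary.Any using (here; there)
open import Data.Maybe.Base using (Maybe; just; nothing)
open import Data.Nat.Base as ℕ using (zero; suc; ∣_-_∣; _≡ᵇ_; _≤ᵇ_)
open import Data.Nat.DivMod using (_/_; _%_; _mod_)
import Data.Nat.Properties as ℕ
open import Data.Product.Base using (∃; _,_; proj₁; proj₂)
open import Data.Rational.Base as ℚ using (ℚ; 0ℚ; ½; Positive)
open import Data.Rational.Properties
  using ( +-assoc; +-comm; +-identityˡ; +-identityʳ; +-mono-≤; +-monoˡ-≤; +-monoʳ-≤
        ; +-mono-<; +-monoˡ-<; +-monoʳ-<; *-zeroʳ; *-identityˡ; *-distribʳ-+; *-monoʳ-<-pos
        ; ≤-refl; ≤-reflexive; ≤-trans; ≤-total; <-irrefl; <-trans; ≤-<-trans; <⇒≤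
        ; ≮⇒≥; ≰⇒>; _<?_; 0≤∣p∣; 0≤p⇒∣p∣≡p; module ≤-Reasoning )
open import Data.Rational.Solver using (module +-*-Solver)
open import Data.Sum.Base as Sum using (_⊎_; inj₁; inj₂)
open import Data.Unit.Base using (⊤; tt)
open import Data.Vec.Relation.Unary.All using ([]; _∷_)
open import Function.Base using (_$_)
open import Function.Bundles using (module Bijection; module Equivalence)
open import Function.Properties.Inverse using (Inverse⇒Injection)
open import Relation.Binary.Construct.Closure.ReflexiveTransitive using (ε; _◅_)
open import Relation.Binary.Definitions using (DecidableEquality)
open import Relation.Binary.PropositionalEquality
  using (_≡_; _≢_; refl; sym; trans; cong; cong₂; subst; subst₂; module ≡-Reasoning)
open import Relation.Nullary.Decidable using (yes; no; via-injection)

-- Tree metrics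

-- The prototype of a forbidden pattern is a 6-cycle with `aᵢ` and `bᵢ` opposite: if its three
-- diagonals were all long, the identity would beat every other permutation, because the six
-- remaining entries are edges. Over the Cauchy reals it cannot be decided whether a nonadjacent
-- pair is short or long. The goal is a contradiction, however, so finitely many double-negated
-- comparisons may be assumed together. Each of them is strict and therefore survives at a
-- sufficiently late index `N`, where all weights are rational. It is the weights that are
-- approximated, not the distances: at each index the same tree then carries a genuine rational tree
-- metric with an exact four-point condition, whereas approximants of the distances would satisfy it
-- only up to an error.

module TreeMetric (G : Graph) (isTree : IsTree G)
  (weight     : ∀ x y → .(Graph._~_ G x y) → ℚ)
  (weight-sym : ∀ {x y} (e : Graph._~_ G x y) → weight x y e ≡ weight y x (Graph.~-sym G e))
  (weight≥0   : ∀ x y .(e : Graph._~_ G x y) → 0ℚ ℚ.≤ weight x y e)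
  where

  open Graph G
  open IsTree isTree

  _≟_ : DecidableEquality Vertex
  _≟_ = via-injection (Inverse⇒Injection finite) Fin._≟_

  len : ∀ {x y} → Walk x y → ℚ
  len ε                   = 0ℚ
  len (_◅_ {x} {y} e p) = weight x y e ℚ.+ len p

  dist : Vertex → Vertex → ℚ
  dist x y = len (path x y)

  private
    variable
      a b c d x y z : Vertex

  source∈ : (p : Walk x y) → x ∈ vertices p
  source∈ ε       = here refl
  source∈ (_ ◅ _) = here refl

  same-source : (p : Walk x a) (q : Walk y b) → vertices p ≡ vertices q → x ≡ y
  same-source ε       ε       eq = ∷-injectiveˡ eq
  same-source ε       (_ ◅ _) eq = ∷-injectiveˡ eq
  same-source (_ ◅ _) ε       eq = ∷-injectiveˡ eq
  same-source (_ ◅ _) (_ ◅ _) eq = ∷-injectiveˡ eq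

  len-cong : (p q : Walk x y) → p ≈ʷ q → len p ≡ len q
  len-cong ε       ε       _  = refl
  -- Splitting the tail lets `vertices` reduce far enough for the two lists to differ visibly in
  -- length.
  len-cong ε       (_ ◅ ε) ()
  len-cong ε       (_ ◅ (_ ◅ _)) ()
  len-cong (_ ◅ ε) ε       ()
  len-cong (_ ◅ (_ ◅ _)) ε ()
  len-cong (_◅_ {x} {y} e p) (f ◅ q) eq
    with refl ← same-source p q (∷-injectiveʳ eq)
    = cong (weight x y e ℚ.+_) (len-cong p q (∷-injectiveʳ eq))

  path-unique : (p q : Walk x y) → IsPath p → IsPath q → p ≈ʷ q
  path-unique {x} {y} p q p-path q-path =
    trans (sym (unique p-path)) (unique q-path)
    where
    unique : ∀ {r} → IsPath r → path x y ≈ʷ r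
    unique = proj₂ (proj₂ (uniquePath x y))

  dist-path : (p : Walk x y) → IsPath p → dist x y ≡ len p
  dist-path {x} {y} p p-path =
    len-cong (path x y) p (proj₂ (proj₂ (uniquePath x y)) p-path)

  tail-path : (e : x ~ y) (p : Walk y z) → IsPath (e ◅ p) → IsPath p
  tail-path _ _ (_ ∷ p-path) = p-path

  prefix : (p : Walk x y) → z ∈ vertices p → Walk x z
  prefix ε       (here refl) = ε
  prefix (_ ◅ _) (here refl) = ε
  prefix (e ◅ p) (there z∈)  = e ◅ prefix p z∈

  prefix-⊆ : ∀ {w} (p : Walk x y) (z∈ : z ∈ vertices p) →
    w ∈ vertices (prefix p z∈) → w ∈ vertices p
  prefix-⊆ ε       (here refl) w∈         = w∈
  prefix-⊆ (_ ◅ _) (here refl) (here eq)  = here eq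
  prefix-⊆ (_ ◅ _) (there z∈)  (here eq)  = here eq
  prefix-⊆ (_ ◅ p) (there z∈)  (there w∈) = there (prefix-⊆ p z∈ w∈)

  prefix-path : (p : Walk x y) (z∈ : z ∈ vertices p) → IsPath p → IsPath (prefix p z∈)
  prefix-path ε       (here refl) p-path        = p-path
  prefix-path (_ ◅ _) (here refl) _             = [] ∷ []
  prefix-path (_ ◅ p) (there z∈)  (x∉ ∷ p-path) =
    All.tabulate (λ w∈ → All.lookup x∉ (prefix-⊆ p z∈ w∈)) ∷ prefix-path p z∈ p-path

  MeetAtSource : Walk d a → Walk d b → Set
  MeetAtSource {d} p q = ∀ {z} → z ∈ vertices p → z ∈ vertices q → z ≡ d

  -- A second common vertex `z` would be reached by two paths from `d` with different second
  -- vertices, against uniqueness of paths.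
  diverge : (e : d ~ x) (p : Walk x a) (f : d ~ y) (q : Walk y b) →
    IsPath (e ◅ p) → IsPath (f ◅ q) → x ≢ y → MeetAtSource (e ◅ p) (f ◅ q)
  diverge e p f q p-path q-path x≢y (here eq) _         = eq
  diverge e p f q p-path q-path x≢y (there _) (here eq) = eq
  diverge e p f q p-path q-path x≢y (there z∈p) (there z∈q) =
    ⊥-elim (x≢y (same-source (prefix p z∈p) (prefix q z∈q) (∷-injectiveʳ prefixes-agree)))
    where
    prefixes-agree : (e ◅ prefix p z∈p) ≈ʷ (f ◅ prefix q z∈q)
    prefixes-agree = path-unique (e ◅ prefix p z∈p) (f ◅ prefix q z∈q)
      (prefix-path (e ◅ p) (there z∈p) p-path) (prefix-path (f ◅ q) (there z∈q) q-path)

  -- Moves the first walk onto the second one edge at a time, reversing it. The common source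
  -- travels along with it, so the only invariant that `glue-path` has to carry is that the walks
  -- meet just there.
  glue : Walk d a → Walk d b → Walk a b
  glue ε       q = q
  glue (e ◅ p) q = glue p (~-sym e ◅ q)

  len-glue : (p : Walk d a) (q : Walk d b) → len (glue p q) ≡ len p ℚ.+ len q
  len-glue ε q = sym (+-identityˡ (len q))
  len-glue (_◅_ {x} {y} e p) q = begin
    len (glue p (~-sym e ◅ q))                 ≡⟨ len-glue p (~-sym e ◅ q) ⟩
    len p ℚ.+ (weight y x (~-sym e) ℚ.+ len q) ≡⟨ +-assoc (len p) _ (len q) ⟨
    (len p ℚ.+ weight y x (~-sym e)) ℚ.+ len q ≡⟨ cong (ℚ._+ len q) (+-comm (len p) _) ⟩
    (weight y x (~-sym e) ℚ.+ len p) ℚ.+ len q ≡⟨ cong (λ w → (w ℚ.+ len p) ℚ.+ len q) (weight-sym e) ⟨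
    (weight x y e ℚ.+ len p) ℚ.+ len q ∎
    where open ≡-Reasoning

  glue-path : (p : Walk d a) (q : Walk d b) → IsPath p → IsPath q → MeetAtSource p q →
    IsPath (glue p q)
  glue-path ε q _ q-path _ = q-path
  glue-path {d} (e ◅ p) q (d∉p ∷ p-path) q-path meet =
    glue-path p (~-sym e ◅ q) p-path (x∉q ∷ q-path) meet′
    where
    disjoint : ∀ {z} → z ∈ vertices p → ¬ z ∈ vertices q
    disjoint z∈p z∈q = All.lookup d∉p z∈p (sym (meet (there z∈p) z∈q))

    x∉q = All.tabulate λ { z∈q refl → disjoint (source∈ p) z∈q }

    meet′ : MeetAtSource p (~-sym e ◅ q)
    meet′ _   (here eq)   = eq
    meet′ z∈p (there z∈q) = ⊥-elim (disjoint z∈p z∈q)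

  dist-glue : (p : Walk d a) (q : Walk d b) → IsPath p → IsPath q → MeetAtSource p q →
    dist a b ≡ len p ℚ.+ len q
  dist-glue p q p-path q-path meet =
    trans (dist-path (glue p q) (glue-path p q p-path q-path meet)) (len-glue p q)

  meet-trivialˡ : (q : Walk d b) → MeetAtSource ε q
  meet-trivialˡ _ (here eq) _ = eq

  meet-trivialʳ : (p : Walk d b) → MeetAtSource p ε
  meet-trivialʳ _ _ (here eq) = eq

  path-isPath : ∀ x y → IsPath (path x y)
  path-isPath x y = proj₁ (proj₂ (uniquePath x y))

  dist-sym : ∀ x y → dist x y ≡ dist y x
  dist-sym x y = sym (trans
    (dist-glue (path x y) ε (path-isPath x y) ([] ∷ []) (meet-trivialʳ (path x y)))
    (+-identityʳ (dist x y)))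

  -- Once shared initial edges are stripped, the paths separate and their lengths add up to the
  -- distance exactly. The stripped edges only enlarge the right-hand side, by nonnegativity of the
  -- weights.
  triangle : (p : Walk d a) (q : Walk d b) → IsPath p → IsPath q →
    dist a b ℚ.≤ len p ℚ.+ len q
  triangle ε q p-path q-path =
    ≤-reflexive (dist-glue ε q p-path q-path (meet-trivialˡ q))
  triangle p@(_ ◅ _) ε p-path q-path =
    ≤-reflexive (dist-glue p ε p-path q-path (meet-trivialʳ p))
  triangle {a = a} {b = b} (_◅_ {d} {x} e p) (_◅_ {d} {y} f q) p-path q-path with x ≟ y
  ... | no x≢y = ≤-reflexive
    (dist-glue (e ◅ p) (f ◅ q) p-path q-path (diverge e p f q p-path q-path x≢y))
  ... | yes refl = begin
    dist a b        ≤⟨ triangle p q (tail-path e p p-path) (tail-path f q q-path) ⟩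
    len p ℚ.+ len q ≤⟨ +-mono-≤ (enlarge (len p)) (enlarge (len q)) ⟩
    (weight d x e ℚ.+ len p) ℚ.+ (weight d x f ℚ.+ len q) ∎
    where
    open ≤-Reasoning
    enlarge : ∀ r → r ℚ.≤ weight d x e ℚ.+ r
    enlarge r = begin
      r        ≡⟨ +-identityˡ r ⟨
      0ℚ ℚ.+ r ≤⟨ +-monoˡ-≤ r (weight≥0 d x e) ⟩
      weight d x e ℚ.+ r ∎

  private
    swap-first : ∀ s t r → s ℚ.+ (t ℚ.+ r) ≡ r ℚ.+ (s ℚ.+ t)
    swap-first s t r = trans (sym (+-assoc s t r)) (+-comm (s ℚ.+ t) r)

    shift : ∀ w s t s′ t′ → s ℚ.+ t ℚ.≤ s′ ℚ.+ t′ → (w ℚ.+ s) ℚ.+ t ℚ.≤ (w ℚ.+ s′) ℚ.+ t′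
    shift w s t s′ t′ le =
      subst₂ ℚ._≤_ (sym (+-assoc w s t)) (sym (+-assoc w s′ t′)) (+-monoʳ-≤ w le)

    -- Paths that separate at `d` put `d` between `a` and `b`, so `dist a b` splits exactly there,
    -- while `dist b c` is bounded by the detour through `d`.
    meet⇒bound : (p : Walk d a) (q : Walk d b) (r : Walk d c) →
      IsPath p → IsPath q → IsPath r → MeetAtSource p q →
      len p ℚ.+ dist b c ℚ.≤ len r ℚ.+ dist a b
    meet⇒bound {a = a} {b = b} {c = c} p q r p-path q-path r-path meet = begin
      len p ℚ.+ dist b c          ≤⟨ +-monoʳ-≤ (len p) (triangle q r q-path r-path) ⟩
      len p ℚ.+ (len q ℚ.+ len r) ≡⟨ swap-first (len p) (len q) (len r) ⟩
      len r ℚ.+ (len p ℚ.+ len q) ≡⟨ cong (len r ℚ.+_) (dist-glue p q p-path q-path meet) ⟨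
      len r ℚ.+ dist a b ∎
      where open ≤-Reasoning

  -- Strip the common first edge of the three paths until the path to a
  -- separates from one of the other two.
  fourPoint-walks : (p : Walk d a) (q : Walk d b) (r : Walk d c) →
    IsPath p → IsPath q → IsPath r →
    (len p ℚ.+ dist b c ℚ.≤ len q ℚ.+ dist a c) ⊎ (len p ℚ.+ dist b c ℚ.≤ len r ℚ.+ dist a b)
  fourPoint-walks ε q r pp pq pr =
    inj₂ (meet⇒bound ε q r pp pq pr (meet-trivialˡ q))
  fourPoint-walks p@(_ ◅ _) ε r pp pq pr =
    inj₂ (meet⇒bound p ε r pp pq pr (meet-trivialʳ p))
  fourPoint-walks {a = a} {b} {c} p@(_ ◅ _) q@(_ ◅ _) ε pp pq pr =
    inj₁ (subst (λ t → len p ℚ.+ t ℚ.≤ len q ℚ.+ dist a c) (dist-sym c b)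
      (meet⇒bound p ε q pp pr pq (meet-trivialʳ p)))
  fourPoint-walks {a = a} {b} {c}
    (_◅_ {d} {x} e p) (_◅_ {d} {y} f q) (_◅_ {d} {z} g r) pp pq pr
    with x ≟ y | x ≟ z
  ... | no x≢y | _ =
    inj₂ (meet⇒bound (e ◅ p) (f ◅ q) (g ◅ r) pp pq pr (diverge e p f q pp pq x≢y))
  ... | yes _ | no x≢z =
    inj₁ (subst (λ t → len (e ◅ p) ℚ.+ t ℚ.≤ len (f ◅ q) ℚ.+ dist a c) (dist-sym c b)
      (meet⇒bound (e ◅ p) (g ◅ r) (f ◅ q) pp pr pq (diverge e p g r pp pr x≢z)))
  ... | yes refl | yes refl
    with fourPoint-walks p q r (tail-path e p pp) (tail-path f q pq) (tail-path g r pr)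
  ...   | inj₁ le = inj₁ (shift (weight d x e) (len p) (dist b c) (len q) (dist a c) le)
  ...   | inj₂ le = inj₂ (shift (weight d x e) (len p) (dist b c) (len r) (dist a b) le)

  fourPoint : ∀ a b c d →
    (dist a b ℚ.+ dist c d ℚ.≤ dist a c ℚ.+ dist b d) ⊎
    (dist a b ℚ.+ dist c d ℚ.≤ dist a d ℚ.+ dist b c)
  fourPoint a b c d = fourPoint-walks (path a b) (path a c) (path a d)
    (path-isPath a b) (path-isPath a c) (path-isPath a d)

-- The hexagon inequality

≤⇒≯ : ∀ {p q : ℚ} → p ℚ.≤ q → ¬ (q ℚ.< p)
≤⇒≯ p≤q q<p = <-irrefl refl (≤-<-trans p≤q q<p)

module Hexagon {A : Set} (D : A → A → ℚ) (D-sym : ∀ p q → D p q ≡ D q p)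
  (fourPoint : ∀ a b c d →
    (D a b ℚ.+ D c d ℚ.≤ D a c ℚ.+ D b d) ⊎ (D a b ℚ.+ D c d ℚ.≤ D a d ℚ.+ D b c))
  where

  private
    chain : ∀ p q s t u v w →
      p ℚ.≤ u ℚ.+ v → q ℚ.+ u ℚ.≤ s ℚ.+ t → s ℚ.+ v ℚ.≤ w → q ℚ.+ p ℚ.≤ t ℚ.+ w
    chain p q s t u v w p≤ qu≤ sv≤ = begin
      q ℚ.+ p         ≤⟨ +-monoʳ-≤ q p≤ ⟩
      q ℚ.+ (u ℚ.+ v) ≡⟨ +-assoc q u v ⟨
      (q ℚ.+ u) ℚ.+ v ≤⟨ +-monoˡ-≤ v qu≤ ⟩
      (s ℚ.+ t) ℚ.+ v ≡⟨ cong (ℚ._+ v) (+-comm s t) ⟩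
      (t ℚ.+ s) ℚ.+ v ≡⟨ +-assoc t s v ⟩
      t ℚ.+ (s ℚ.+ v) ≤⟨ +-monoʳ-≤ t sv≤ ⟩
      t ℚ.+ w ∎
      where open ≤-Reasoning

    middle : ∀ a b c t w → w ℚ.+ t ℚ.< a ℚ.+ c → t ℚ.+ (w ℚ.+ b) ℚ.< a ℚ.+ (b ℚ.+ c)
    middle a b c t w wt<ac = begin-strict
      t ℚ.+ (w ℚ.+ b) ≡⟨ +-assoc t w b ⟨
      (t ℚ.+ w) ℚ.+ b ≡⟨ cong (ℚ._+ b) (+-comm t w) ⟩
      (w ℚ.+ t) ℚ.+ b <⟨ +-monoˡ-< b wt<ac ⟩
      (a ℚ.+ c) ℚ.+ b ≡⟨ +-assoc a c b ⟩
      a ℚ.+ (c ℚ.+ b) ≡⟨ cong (a ℚ.+_) (+-comm c b) ⟩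
      a ℚ.+ (b ℚ.+ c) ∎
      where open ≤-Reasoning

    last : ∀ a b c t w → w ℚ.+ t ℚ.< a ℚ.+ b → t ℚ.+ (w ℚ.+ c) ℚ.< a ℚ.+ (b ℚ.+ c)
    last a b c t w wt<ab =
      subst (t ℚ.+ (w ℚ.+ c) ℚ.<_) (cong (a ℚ.+_) (+-comm c b)) (middle a c b t w wt<ab)

  -- The identity cannot be the only permutation attaining the tropical
  -- determinant of the matrix (D aᵢ bⱼ).
  hexagon : ∀ a₁ a₂ a₃ b₁ b₂ b₃ →
    D a₁ b₂ ℚ.+ D a₂ b₁ ℚ.< D a₁ b₁ ℚ.+ D a₂ b₂ →
    D a₁ b₃ ℚ.+ D a₃ b₁ ℚ.< D a₁ b₁ ℚ.+ D a₃ b₃ →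
    D a₂ b₃ ℚ.+ D a₃ b₂ ℚ.< D a₂ b₂ ℚ.+ D a₃ b₃ →
    D a₃ b₁ ℚ.+ (D a₁ b₂ ℚ.+ D a₂ b₃) ℚ.< D a₁ b₁ ℚ.+ (D a₂ b₂ ℚ.+ D a₃ b₃) →
    D a₂ b₁ ℚ.+ (D a₁ b₃ ℚ.+ D a₃ b₂) ℚ.< D a₁ b₁ ℚ.+ (D a₂ b₂ ℚ.+ D a₃ b₃) →
    ⊥
  -- Exchanging the partners of `a₂` and `a₃` contradicts `h₂₃`, so their sum is bounded by
  -- `D a₂ a₃ + D b₂ b₃`. Two more applications of the four-point condition trade these auxiliary
  -- distances away. They end in a 3-cycle, or in a transposition whose fixed summand cancels.
  hexagon a₁ a₂ a₃ b₁ b₂ b₃ h₁₂ h₁₃ h₂₃ h₁₂₃ h₁₃₂ with fourPoint a₂ b₂ a₃ b₃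
  ... | inj₂ le =
    ≤⇒≯ (subst (λ r → D a₂ b₂ ℚ.+ D a₃ b₃ ℚ.≤ D a₂ b₃ ℚ.+ r) (D-sym b₂ a₃) le) h₂₃
  ... | inj₁ p≤ with fourPoint a₁ b₁ a₂ a₃
  ...   | inj₁ q≤ = conclude (fourPoint a₁ a₂ b₂ b₃)
    where
    through : ∀ {w} → D a₁ a₂ ℚ.+ D b₂ b₃ ℚ.≤ w →
      D a₁ b₁ ℚ.+ (D a₂ b₂ ℚ.+ D a₃ b₃) ℚ.≤ D a₃ b₁ ℚ.+ w
    through = chain (D a₂ b₂ ℚ.+ D a₃ b₃) (D a₁ b₁) (D a₁ a₂) (D a₃ b₁) (D a₂ a₃) (D b₂ b₃) _ p≤
      (subst (λ r → D a₁ b₁ ℚ.+ D a₂ a₃ ℚ.≤ D a₁ a₂ ℚ.+ r) (D-sym b₁ a₃) q≤)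

    conclude : _ → ⊥
    conclude (inj₁ s≤) = ≤⇒≯ (through s≤) h₁₂₃
    conclude (inj₂ s≤) = ≤⇒≯ (through s≤)
      (middle (D a₁ b₁) (D a₂ b₂) (D a₃ b₃) (D a₃ b₁) (D a₁ b₃) h₁₃)
  ...   | inj₂ q≤ = conclude (fourPoint a₁ a₃ b₂ b₃)
    where
    through : ∀ {w} → D a₁ a₃ ℚ.+ D b₂ b₃ ℚ.≤ w →
      D a₁ b₁ ℚ.+ (D a₂ b₂ ℚ.+ D a₃ b₃) ℚ.≤ D a₂ b₁ ℚ.+ w
    through = chain (D a₂ b₂ ℚ.+ D a₃ b₃) (D a₁ b₁) (D a₁ a₃) (D a₂ b₁) (D a₂ a₃) (D b₂ b₃) _ p≤
      (subst (λ r → D a₁ b₁ ℚ.+ D a₂ a₃ ℚ.≤ D a₁ a₃ ℚ.+ r) (D-sym b₁ a₂) q≤)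

    conclude : _ → ⊥
    conclude (inj₁ s≤) = ≤⇒≯ (through s≤)
      (last (D a₁ b₁) (D a₂ b₂) (D a₃ b₃) (D a₂ b₁) (D a₁ b₂) h₁₂)
    conclude (inj₂ s≤) = ≤⇒≯ (through s≤) h₁₃₂

-- Short and long distances in the cube

record Point : Set where
  constructor ⟨_,_,_⟩
  field
    x y z : Fin 3

∣_-_∣₃ : Fin 3 → Fin 3 → ℕ
∣ i - j ∣₃ = ∣ toℕ i - toℕ j ∣

gap : Point → Point → ℕ
gap ⟨ x , y , z ⟩ ⟨ x′ , y′ , z′ ⟩ = ∣ x - x′ ∣₃ ℕ.+ (∣ y - y′ ∣₃ ℕ.+ ∣ z - z′ ∣₃)

∣-∣₃≡0⇒≡ : ∀ i j → ∣ i - j ∣₃ ≡ 0 → i ≡ j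
∣-∣₃≡0⇒≡ i j eq = Fin.toℕ-injective (ℕ.∣m-n∣≡0⇒m≡n eq)

gap≡0⇒≡ : ∀ p q → gap p q ≡ 0 → p ≡ q
gap≡0⇒≡ ⟨ x , y , z ⟩ ⟨ x′ , y′ , z′ ⟩ eq
  with refl ← ∣-∣₃≡0⇒≡ x x′ (ℕ.m+n≡0⇒m≡0 _ eq)
  with eq′ ← ℕ.m+n≡0⇒n≡0 ∣ x - x′ ∣₃ eq
  with refl ← ∣-∣₃≡0⇒≡ y y′ (ℕ.m+n≡0⇒m≡0 _ eq′)
  with refl ← ∣-∣₃≡0⇒≡ z z′ (ℕ.m+n≡0⇒n≡0 ∣ y - y′ ∣₃ eq′) = refl

-- Instead of bounds dmin and dmax, a configuration only records that no length
-- of an edge lies on the wrong side of a nonadjacent pair.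
record Configuration : Set₁ where
  field
    D          : Point → Point → ℚ
    D-sym      : ∀ p q → D p q ≡ D q p
    fourPoint  : ∀ a b c d →
      (D a b ℚ.+ D c d ℚ.≤ D a c ℚ.+ D b d) ⊎ (D a b ℚ.+ D c d ℚ.≤ D a d ℚ.+ D b c)
    EdgeLength : ℚ → Set
    edge       : ∀ p q → gap p q ≡ 1 → EdgeLength (D p q)
    nonedge    : ∀ p q → 2 ℕ.≤ gap p q →
      (∀ e → EdgeLength e → D p q ℚ.< e) ⊎ (∀ e → EdgeLength e → e ℚ.< D p q)

data Colour : Set where
  short medium long : Colour

Fact : Set
Fact = Point × Point × Colour

HasColour : (ℚ → Set) → ℚ → Colour → Set
HasColour E d short  = ∀ e → E e → d ℚ.< e
HasColour E d medium = E d
HasColour E d long   = ∀ e → E e → e ℚ.< d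

infix 3 _⊨_

_⊨_ : Configuration → Fact → Set
C ⊨ p , q , c = HasColour EdgeLength (D p q) c
  where open Configuration C

-- Quantifying over all configurations lets a pattern be reused at each of its symmetric images: it
-- is applied to a pulled-back configuration.
Forbidden : List Fact → Set₁
Forbidden fs = ∀ C → ¬ All (C ⊨_) fs

-- Symmetries of the cube

data Generator : Set where
  rotate swap reflect : Generator

generate : Generator → Point → Point
generate rotate  ⟨ x , y , z ⟩ = ⟨ y , z , x ⟩
generate swap    ⟨ x , y , z ⟩ = ⟨ y , x , z ⟩
generate reflect ⟨ x , y , z ⟩ = ⟨ opposite x , y , z ⟩

gap-generate : ∀ g p q → gap (generate g p) (generate g q) ≡ gap p q
gap-generate rotate ⟨ x , y , z ⟩ ⟨ x′ , y′ , z′ ⟩ =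
  trans (sym (ℕ.+-assoc ∣ y - y′ ∣₃ _ _)) (ℕ.+-comm _ ∣ x - x′ ∣₃)
gap-generate swap ⟨ x , y , z ⟩ ⟨ x′ , y′ , z′ ⟩ =
  trans (sym (ℕ.+-assoc ∣ y - y′ ∣₃ _ _))
    (trans (cong (ℕ._+ ∣ z - z′ ∣₃) (ℕ.+-comm ∣ y - y′ ∣₃ _)) (ℕ.+-assoc ∣ x - x′ ∣₃ _ _))
gap-generate reflect ⟨ x , y , z ⟩ ⟨ x′ , y′ , z′ ⟩ = cong (ℕ._+ _) (opposite-gap x x′)
  where
  opposite-gap : ∀ i j → ∣ opposite i - opposite j ∣₃ ≡ ∣ i - j ∣₃
  opposite-gap zero             zero             = refl
  opposite-gap zero             (suc zero)       = refl
  opposite-gap zero             (suc (suc zero)) = refl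
  opposite-gap (suc zero)       zero             = refl
  opposite-gap (suc zero)       (suc zero)       = refl
  opposite-gap (suc zero)       (suc (suc zero)) = refl
  opposite-gap (suc (suc zero)) zero             = refl
  opposite-gap (suc (suc zero)) (suc zero)       = refl
  opposite-gap (suc (suc zero)) (suc (suc zero)) = refl

-- Words in the generators, the head acting last. `rotate` and `swap` give all permutations of the
-- coordinates and conjugates of `reflect` give all reflections, hence the whole group of order 48.
Symmetry : Set
Symmetry = List Generator

act : Symmetry → Point → Point
act []       p = p
act (g ∷ gs) p = generate g (act gs p)

gap-act : ∀ gs p q → gap (act gs p) (act gs q) ≡ gap p q
gap-act []       p q = refl
gap-act (g ∷ gs) p q = trans (gap-generate g (act gs p) (act gs q)) (gap-act gs p q)

actᶠ : Symmetry → Fact → Fact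
actᶠ gs (p , q , c) = act gs p , act gs q , c

pullback : Symmetry → Configuration → Configuration
pullback gs C = record
  { D          = λ p q → D (act gs p) (act gs q)
  ; D-sym      = λ p q → D-sym (act gs p) (act gs q)
  ; fourPoint  = λ a b c d → fourPoint (act gs a) (act gs b) (act gs c) (act gs d)
  ; EdgeLength = EdgeLength
  ; edge       = λ p q g → edge (act gs p) (act gs q) (trans (gap-act gs p q) g)
  ; nonedge    = λ p q g → nonedge (act gs p) (act gs q) (subst (2 ℕ.≤_) (sym (gap-act gs p q)) g)
  }
  where open Configuration C

-- A boolean checker for refutations

same : Point → Point → Bool
same p q = gap p q ≡ᵇ 0

recall : List Fact → Point → Point → Maybe Colour
recall []                   p q = nothing
recall ((p′ , q′ , c) ∷ fs) p q =
  if (same p′ p ∧ same q′ q) ∨ (same p′ q ∧ same q′ p) then just c else recall fs p q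

colour : List Fact → Point → Point → Maybe Colour
colour fs p q = if gap p q ≡ᵇ 1 then just medium else recall fs p q

-- Distances of one colour may come in either order and an undecided distance compares with nothing,
-- hence the default `false`.
_≺_ : Maybe Colour → Maybe Colour → Bool
just short  ≺ just medium = true
just short  ≺ just long   = true
just medium ≺ just long   = true
_           ≺ _           = false

infix 7 _≺_ _≺₂_ _≺₃_

-- The sum of distances with the colours on the left is smaller if some matching
-- with the colours on the right makes every single distance smaller.
_≺₂_ : Maybe Colour × Maybe Colour → Maybe Colour × Maybe Colour → Bool
(c , d) ≺₂ (c′ , d′) = (c ≺ c′ ∧ d ≺ d′) ∨ (c ≺ d′ ∧ d ≺ c′)

_≺₃_ : Maybe Colour × Maybe Colour × Maybe Colour →
       Maybe Colour × Maybe Colour × Maybe Colour → Bool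
(c , d , e) ≺₃ (c′ , d′ , e′) =
  (c ≺ c′ ∧ (d , e) ≺₂ (d′ , e′)) ∨
  ((c ≺ d′ ∧ (d , e) ≺₂ (c′ , e′)) ∨
  (c ≺ e′ ∧ (d , e) ≺₂ (c′ , d′)))

-- Points are written in certificates by their coordinates, 012 for ⟨ 0 , 1 , 2 ⟩.
point : ℕ → Point
point n = ⟨ (n / 100) mod 3 , (n / 10 % 10) mod 3 , (n % 10) mod 3 ⟩

-- `earlier n gs` appeals to the image under gs of the n-th forbidden pattern
-- established before; `split p q` treats a short and then a long distance.
data Refutation : Set where
  hexagon : (a₁ a₂ a₃ b₁ b₂ b₃ : ℕ) → Refutation
  earlier : ℕ → Symmetry → Refutation
  split   : ℕ → ℕ → Refutation → Refutation → Refutation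

agrees : Maybe Colour → Colour → Bool
agrees (just short)  short  = true
agrees (just medium) medium = true
agrees (just long)   long   = true
agrees _             _      = false

entails : List Fact → List Fact → Bool
entails fs []                 = true
entails fs ((p , q , c) ∷ gs) = agrees (colour fs p q) c ∧ entails fs gs

hexagonBreaks : List Fact → (a₁ a₂ a₃ b₁ b₂ b₃ : Point) → Bool
hexagonBreaks fs a₁ a₂ a₃ b₁ b₂ b₃ =
  ((a₁ · b₂ , a₂ · b₁) ≺₂ (a₁ · b₁ , a₂ · b₂)) ∧
  (((a₁ · b₃ , a₃ · b₁) ≺₂ (a₁ · b₁ , a₃ · b₃)) ∧
  (((a₂ · b₃ , a₃ · b₂) ≺₂ (a₂ · b₂ , a₃ · b₃)) ∧
  (((a₃ · b₁ , a₁ · b₂ , a₂ · b₃) ≺₃ (a₁ · b₁ , a₂ · b₂ , a₃ · b₃)) ∧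
  ((a₂ · b₁ , a₁ · b₃ , a₃ · b₂) ≺₃ (a₁ · b₁ , a₂ · b₂ , a₃ · b₃)))))
  where
  _·_ : Point → Point → Maybe Colour
  _·_ = colour fs

recallPattern : List (List Fact) → ℕ → Maybe (List Fact)
recallPattern []       _       = nothing
recallPattern (p ∷ _)  zero    = just p
recallPattern (_ ∷ ps) (suc n) = recallPattern ps n

entails? : List Fact → Symmetry → Maybe (List Fact) → Bool
entails? fs gs nothing  = false
entails? fs gs (just p) = entails fs (map (actᶠ gs) p)

refutes : List (List Fact) → List Fact → Refutation → Bool
refutes Γ fs (hexagon a₁ a₂ a₃ b₁ b₂ b₃) =
  hexagonBreaks fs (point a₁) (point a₂) (point a₃) (point b₁) (point b₂) (point b₃)
refutes Γ fs (earlier n gs) = entails? fs gs (recallPattern Γ n)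
refutes Γ fs (split p q r s) =
  (2 ≤ᵇ gap (point p) (point q)) ∧
  (refutes Γ ((point p , point q , short) ∷ fs) r ∧ refutes Γ ((point p , point q , long) ∷ fs) s)

-- Soundness of the checker

∧⁻ : ∀ {x y} → T (x ∧ y) → T x × T y
∧⁻ = Equivalence.to T-∧

∨⁻ : ∀ {x y} → T (x ∨ y) → T x ⊎ T y
∨⁻ = Equivalence.to T-∨

same⇒≡ : ∀ p q → T (same p q) → p ≡ q
same⇒≡ p q t = gap≡0⇒≡ p q (ℕ.≡ᵇ⇒≡ (gap p q) 0 t)

module _ (C : Configuration) where
  open Configuration C
  open Hexagon D D-sym fourPoint using () renaming (hexagon to hexagon-inequality)

  MaybeColour : ℚ → Maybe Colour → Set
  MaybeColour r nothing  = ⊤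
  MaybeColour r (just c) = HasColour EdgeLength r c

  recall-sound : ∀ {fs} → All (C ⊨_) fs → ∀ p q → MaybeColour (D p q) (recall fs p q)
  recall-sound []                                  p q = tt
  recall-sound {(p′ , q′ , c) ∷ fs} (h ∷ hs) p q
    with (same p′ p ∧ same q′ q) ∨ (same p′ q ∧ same q′ p) in eq
  ... | false = recall-sound hs p q
  ... | true with ∨⁻ (subst T (sym eq) tt)
  ...   | inj₁ t with refl ← same⇒≡ p′ p (proj₁ (∧⁻ t)) | refl ← same⇒≡ q′ q (proj₂ (∧⁻ t)) = h
  ...   | inj₂ t with refl ← same⇒≡ p′ q (proj₁ (∧⁻ t)) | refl ← same⇒≡ q′ p (proj₂ (∧⁻ t)) =
    subst (λ d → HasColour EdgeLength d c) (D-sym q p) h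

  colour-sound : ∀ {fs} → All (C ⊨_) fs → ∀ p q → MaybeColour (D p q) (colour fs p q)
  colour-sound hs p q with gap p q ≡ᵇ 1 in eq
  ... | false = recall-sound hs p q
  ... | true  = edge p q (ℕ.≡ᵇ⇒≡ (gap p q) 1 (subst T (sym eq) tt))

  ≺-sound : ∀ {r s} c d → MaybeColour r c → MaybeColour s d → T (c ≺ d) → r ℚ.< s
  ≺-sound (just short)  (just medium) r<  s∈ _ = r< _ s∈
  -- Both colours are defined relative to edge lengths only, so some edge has to mediate; an
  -- arbitrary one is taken.
  ≺-sound (just short)  (just long)   r<  <s _ = <-trans (r< _ some-edge) (<s _ some-edge)
    where
    some-edge : EdgeLength (D (point 000) (point 001))
    some-edge = edge (point 000) (point 001) refl
  ≺-sound (just medium) (just long)   r∈  <s _ = <s _ r∈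

  ≺₂-sound : ∀ {r s r′ s′} c d c′ d′ →
    MaybeColour r c → MaybeColour s d → MaybeColour r′ c′ → MaybeColour s′ d′ →
    T ((c , d) ≺₂ (c′ , d′)) → r ℚ.+ s ℚ.< r′ ℚ.+ s′
  ≺₂-sound {r} {s} {r′} {s′} c d c′ d′ hc hd hc′ hd′ t with ∨⁻ t
  ... | inj₁ u = +-mono-< (≺-sound c c′ hc hc′ (proj₁ (∧⁻ u))) (≺-sound d d′ hd hd′ (proj₂ (∧⁻ u)))
  ... | inj₂ u = subst (r ℚ.+ s ℚ.<_) (+-comm s′ r′)
    (+-mono-< (≺-sound c d′ hc hd′ (proj₁ (∧⁻ u))) (≺-sound d c′ hd hc′ (proj₂ (∧⁻ u))))

  ≺₃-sound : ∀ {r s t r′ s′ t′} c d e c′ d′ e′ →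
    MaybeColour r c → MaybeColour s d → MaybeColour t e →
    MaybeColour r′ c′ → MaybeColour s′ d′ → MaybeColour t′ e′ →
    T ((c , d , e) ≺₃ (c′ , d′ , e′)) → r ℚ.+ (s ℚ.+ t) ℚ.< r′ ℚ.+ (s′ ℚ.+ t′)
  ≺₃-sound {r} {s} {t} {r′} {s′} {t′} c d e c′ d′ e′ hc hd he hc′ hd′ he′ τ with ∨⁻ τ
  ... | inj₁ u = +-mono-< (≺-sound c c′ hc hc′ (proj₁ (∧⁻ u)))
    (≺₂-sound d e d′ e′ hd he hd′ he′ (proj₂ (∧⁻ u)))
  ... | inj₂ τ′ with ∨⁻ τ′
  ...   | inj₁ u = subst (r ℚ.+ (s ℚ.+ t) ℚ.<_) (exchange s′ r′ t′)
    (+-mono-< (≺-sound c d′ hc hd′ (proj₁ (∧⁻ u))) (≺₂-sound d e c′ e′ hd he hc′ he′ (proj₂ (∧⁻ u))))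
    where
    exchange : ∀ x y z → x ℚ.+ (y ℚ.+ z) ≡ y ℚ.+ (x ℚ.+ z)
    exchange x y z = trans (sym (+-assoc x y z)) (trans (cong (ℚ._+ z) (+-comm x y)) (+-assoc y x z))
  ...   | inj₂ u = subst (r ℚ.+ (s ℚ.+ t) ℚ.<_) (trans (+-comm t′ _) (+-assoc r′ s′ t′))
    (+-mono-< (≺-sound c e′ hc he′ (proj₁ (∧⁻ u))) (≺₂-sound d e c′ d′ hd he hc′ hd′ (proj₂ (∧⁻ u))))

  module _ {fs : List Fact} (hs : All (C ⊨_) fs) where
    private
      κ : Point → Point → Maybe Colour
      κ = colour fs

      κ-sound : ∀ p q → MaybeColour (D p q) (κ p q)
      κ-sound = colour-sound hs

      two : ∀ p q r s p′ q′ r′ s′ →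
        T ((κ p q , κ r s) ≺₂ (κ p′ q′ , κ r′ s′)) → D p q ℚ.+ D r s ℚ.< D p′ q′ ℚ.+ D r′ s′
      two p q r s p′ q′ r′ s′ = ≺₂-sound (κ p q) (κ r s) (κ p′ q′) (κ r′ s′)
        (κ-sound p q) (κ-sound r s) (κ-sound p′ q′) (κ-sound r′ s′)

    hexagon-sound : ∀ a₁ a₂ a₃ b₁ b₂ b₃ → ¬ T (hexagonBreaks fs a₁ a₂ a₃ b₁ b₂ b₃)
    hexagon-sound a₁ a₂ a₃ b₁ b₂ b₃ t
      with t₁₂ , t′ ← ∧⁻ t
      with t₁₃ , t″ ← ∧⁻ t′
      with t₂₃ , t‴ ← ∧⁻ t″
      with t₁₂₃ , t₁₃₂ ← ∧⁻ t‴
      = hexagon-inequality a₁ a₂ a₃ b₁ b₂ b₃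
          (two a₁ b₂ a₂ b₁ a₁ b₁ a₂ b₂ t₁₂)
          (two a₁ b₃ a₃ b₁ a₁ b₁ a₃ b₃ t₁₃)
          (two a₂ b₃ a₃ b₂ a₂ b₂ a₃ b₃ t₂₃)
          (three a₃ b₁ a₁ b₂ a₂ b₃ t₁₂₃)
          (three a₂ b₁ a₁ b₃ a₃ b₂ t₁₃₂)
      where
      three : ∀ p q r s u v →
        T ((κ p q , κ r s , κ u v) ≺₃ (κ a₁ b₁ , κ a₂ b₂ , κ a₃ b₃)) →
        D p q ℚ.+ (D r s ℚ.+ D u v) ℚ.< D a₁ b₁ ℚ.+ (D a₂ b₂ ℚ.+ D a₃ b₃)
      three p q r s u v = ≺₃-sound (κ p q) (κ r s) (κ u v) (κ a₁ b₁) (κ a₂ b₂) (κ a₃ b₃)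
        (κ-sound p q) (κ-sound r s) (κ-sound u v) (κ-sound a₁ b₁) (κ-sound a₂ b₂) (κ-sound a₃ b₃)

    agrees-sound : ∀ {r} m c → MaybeColour r m → T (agrees m c) → HasColour EdgeLength r c
    agrees-sound (just short)  short  h _ = h
    agrees-sound (just medium) medium h _ = h
    agrees-sound (just long)   long   h _ = h

    entails-sound : ∀ gs → T (entails fs gs) → All (C ⊨_) gs
    entails-sound []                 _ = []
    entails-sound ((p , q , c) ∷ gs) t =
      agrees-sound (κ p q) c (κ-sound p q) (proj₁ (∧⁻ t)) ∷ entails-sound gs (proj₂ (∧⁻ t))

recallPattern-sound : ∀ {Γ} → All Forbidden Γ → ∀ n {p} → recallPattern Γ n ≡ just p → Forbidden p
recallPattern-sound (φ ∷ _)  zero    refl = φ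
recallPattern-sound (_ ∷ φs) (suc n) eq   = recallPattern-sound φs n eq

refutes-sound : ∀ {Γ} → All Forbidden Γ → ∀ fs r → T (refutes Γ fs r) → Forbidden fs
refutes-sound φs fs (hexagon a₁ a₂ a₃ b₁ b₂ b₃) t C hs =
  hexagon-sound C hs (point a₁) (point a₂) (point a₃) (point b₁) (point b₂) (point b₃) t
refutes-sound {Γ} φs fs (earlier n gs) t C hs with recallPattern Γ n in eq
-- That `pullback gs C` satisfies a fact unfolds to `C` satisfying its image under `gs`, so `map⁻`
-- is the whole translation.
... | just p = recallPattern-sound φs n eq (pullback gs C)
  (All.map⁻ (entails-sound C hs (map (actᶠ gs) p) t))
refutes-sound φs fs (split p q r s) t C hs
  with apart , t′ ← ∧⁻ {2 ≤ᵇ gap (point p) (point q)} t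
  with Configuration.nonedge C (point p) (point q) (ℕ.≤ᵇ⇒≤ 2 _ apart)
... | inj₁ pq-short = refutes-sound φs _ r (proj₁ (∧⁻ t′)) C (pq-short ∷ hs)
... | inj₂ pq-long  = refutes-sound φs _ s (proj₂ (∧⁻ t′)) C (pq-long ∷ hs)

Certificate : Set
Certificate = List (List Fact × Refutation)

valid : List (List Fact) → Certificate → Bool
valid Γ []             = true
-- Appending at the end keeps the number of each pattern fixed throughout the certificate.
valid Γ ((p , r) ∷ ps) = refutes Γ p r ∧ valid (Γ ∷ʳ p) ps

valid-sound : ∀ Γ Π → All Forbidden Γ → T (valid Γ Π) → All Forbidden (map proj₁ Π)
valid-sound Γ []             φs t = []
valid-sound Γ ((p , r) ∷ ps) φs t = φ ∷ valid-sound (Γ ∷ʳ p) ps (All.∷ʳ⁺ φs φ) (proj₂ (∧⁻ t))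
  where
  φ : Forbidden p
  φ = refutes-sound φs p r (proj₁ (∧⁻ t))

-- The certificate

near far : ℕ → ℕ → Fact
near m n = point m , point n , short
far  m n = point m , point n , long

-- `impossible` refutes the opposite alternative. In the certificate it is always a single step, so
-- that every refutation reads as a linear chain of deductions.
henceNear henceFar : ℕ → ℕ → Refutation → Refutation → Refutation
henceNear m n impossible r = split m n r impossible
henceFar  m n impossible r = split m n impossible r

infix -2 _by_

_by_ : List Fact → Refutation → List Fact × Refutation
_by_ = _,_

lemmas : Certificate
lemmas =
    (near 010 211 ∷ near 122 211 ∷ near 010 121 ∷ far 010 112 ∷ near 010 222 ∷ []
      -- A sample reading: if 111 and 222 were near, the matching 010-112, 111-211, 122-222 with
      -- colours long, medium, medium would strictly exceed every other matching.
      by henceFar 111 222 (hexagon 010 111 122 112 211 222) $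
         henceFar 121 212 (hexagon 010 122 212 112 121 211) $
         henceNear 011 212 (hexagon 010 111 212 112 222 011) $
         hexagon 010 111 212 011 222 121)
  ∷ (near 010 211 ∷ near 122 211 ∷ near 010 121 ∷ near 012 121 ∷ far 010 022 ∷ near 010 222 ∷ []
      by henceNear 012 020 (hexagon 010 012 021 022 020 121) $
         henceNear 012 222 (hexagon 010 012 122 022 222 121) $
         henceNear 021 211 (hexagon 010 021 122 022 211 121) $
         henceNear 010 112 (earlier 0 []) $
         henceFar 021 112 (hexagon 010 012 021 022 112 121) $
         henceNear 020 122 (hexagon 010 021 122 022 112 020) $
         henceFar 021 222 (hexagon 010 021 122 022 112 222) $
         henceNear 011 122 (hexagon 011 112 211 122 021 111) $
         henceNear 020 111 (hexagon 011 020 121 012 111 122) $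
         henceNear 012 110 (hexagon 010 012 111 020 110 121) $
         henceFar 111 222 (hexagon 010 021 111 020 222 121) $
         hexagon 010 012 111 110 112 222)
  ∷ (near 010 112 ∷ far 010 211 ∷ near 010 222 ∷ near 010 121 ∷ []
      by henceFar 112 221 (earlier 0 (swap ∷ rotate ∷ [])) $
         henceNear 111 222 (hexagon 010 111 221 211 222 112) $
         henceNear 121 212 (hexagon 010 212 221 211 121 112) $
         hexagon 010 111 212 211 121 222)
  ∷ (far 020 111 ∷ near 012 121 ∷ near 012 110 ∷ near 012 020 ∷ far 010 211 ∷ []
      by henceFar 012 211 (hexagon 010 012 111 211 011 020) $
         henceFar 020 210 (hexagon 012 111 210 211 020 110) $
         henceFar 020 221 (hexagon 012 111 221 211 020 121) $
         henceFar 012 220 (earlier 2 (rotate ∷ reflect ∷ rotate ∷ rotate ∷ [])) $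
         henceFar 110 221 (hexagon 012 221 120 220 020 110) $
         henceFar 121 210 (hexagon 012 210 120 220 020 121) $
         hexagon 012 210 221 220 121 110)
  ∷ (near 012 020 ∷ far 012 211 ∷ near 012 110 ∷ near 012 121 ∷ far 010 211 ∷ []
      by henceNear 020 111 (earlier 3 []) $
         henceNear 020 210 (hexagon 012 111 210 211 110 020) $
         henceNear 020 221 (hexagon 012 111 221 211 121 020) $
         henceFar 012 220 (earlier 2 (rotate ∷ reflect ∷ rotate ∷ rotate ∷ [])) $
         henceNear 110 221 (hexagon 012 221 120 220 110 020) $
         henceNear 121 210 (hexagon 012 210 120 220 121 020) $
         hexagon 012 210 221 211 110 121)
  ∷ (near 012 222 ∷ far 012 110 ∷ near 121 212 ∷ near 012 121 ∷ near 012 211 ∷ []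
      by henceFar 012 220 (earlier 2 (swap ∷ rotate ∷ reflect ∷ [])) $
         henceNear 110 212 (earlier 4 (reflect ∷ swap ∷ rotate ∷ reflect ∷ [])) $
         henceFar 111 222 (hexagon 012 111 212 110 121 222) $
         henceFar 120 222 (hexagon 012 120 212 110 121 222) $
         henceFar 210 222 (hexagon 012 111 210 110 222 211) $
         henceFar 120 211 (hexagon 012 120 221 220 222 211) $
         henceFar 121 210 (hexagon 012 210 221 220 222 121) $
         hexagon 012 120 210 110 211 121)
  ∷ (far 012 110 ∷ near 121 212 ∷ near 012 121 ∷ near 012 211 ∷ []
      by henceFar 012 222 (earlier 5 []) $
         henceFar 122 211 (hexagon 012 122 212 222 121 211) $
         henceNear 022 212 (hexagon 012 212 122 222 022 121) $
         henceNear 112 221 (hexagon 012 122 221 222 211 112) $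
         henceNear 022 221 (hexagon 012 122 221 222 211 022) $
         henceNear 022 111 (hexagon 022 112 121 111 212 221) $
         henceNear 011 212 (hexagon 011 022 121 212 012 111) $
         henceNear 110 212 (earlier 4 (swap ∷ rotate ∷ reflect ∷ [])) $
         henceFar 110 221 (hexagon 012 212 221 110 112 121) $
         henceNear 121 210 (hexagon 110 121 211 221 210 212) $
         henceFar 120 211 (hexagon 012 120 210 110 121 211) $
         henceNear 011 210 (hexagon 011 110 121 210 012 111) $
         henceNear 112 210 (hexagon 012 210 111 110 112 121) $
         henceFar 112 120 (hexagon 110 112 211 221 111 120) $
         henceNear 111 220 (hexagon 110 211 220 221 120 111) $
         henceNear 212 220 (hexagon 110 211 220 221 120 212) $
         henceNear 210 222 (hexagon 110 112 222 221 212 210) $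
         henceFar 111 222 (hexagon 111 210 212 121 220 222) $
         henceNear 011 221 (hexagon 011 220 222 221 210 212) $
         henceFar 110 122 (hexagon 110 211 222 221 122 111) $
         henceFar 011 120 (hexagon 011 110 112 111 221 120) $
         henceNear 011 122 (hexagon 011 112 121 122 212 221) $
         henceNear 010 121 (hexagon 010 120 122 121 011 110) $
         henceNear 010 112 (hexagon 010 012 111 112 110 121) $
         hexagon 010 212 221 011 112 121)
  ∷ (far 012 222 ∷ far 122 211 ∷ near 012 211 ∷ near 012 121 ∷ []
      by henceNear 112 221 (hexagon 012 122 221 222 211 112) $
         henceNear 022 212 (hexagon 012 122 212 222 211 022) $
         henceNear 121 212 (hexagon 012 122 212 112 211 121) $
         henceNear 022 221 (hexagon 012 122 221 222 211 022) $
         henceNear 012 110 (earlier 6 []) $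
         henceNear 022 111 (hexagon 022 112 121 111 212 221) $
         henceNear 110 212 (hexagon 012 111 212 022 121 110) $
         henceNear 110 221 (hexagon 012 212 221 222 211 110) $
         henceFar 012 220 (earlier 1 (swap ∷ rotate ∷ reflect ∷ [])) $
         henceFar 120 211 (hexagon 012 120 221 220 110 211) $
         henceFar 121 210 (hexagon 012 210 221 220 110 121) $
         hexagon 012 120 210 220 211 121)
  ∷ (near 022 212 ∷ near 011 221 ∷ near 011 122 ∷ near 012 211 ∷ far 122 211 ∷ near 012 121 ∷ []
      by henceNear 012 222 (earlier 7 []) $
         henceNear 112 221 (hexagon 011 112 211 111 221 122) $
         henceNear 121 212 (hexagon 012 122 212 112 211 121) $
         henceNear 012 110 (earlier 5 []) $
         henceNear 111 222 (hexagon 012 111 122 112 222 211) $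
         henceFar 022 111 (hexagon 012 111 212 022 121 222) $
         henceFar 022 221 (hexagon 022 112 121 111 212 221) $
         henceFar 021 211 (hexagon 011 022 211 021 221 122) $
         henceNear 011 212 (hexagon 011 022 211 212 221 021) $
         henceNear 110 212 (earlier 5 (reflect ∷ [])) $
         henceNear 110 122 (hexagon 012 122 212 022 110 222) $
         henceNear 110 221 (hexagon 012 122 221 112 211 110) $
         henceNear 021 110 (hexagon 011 110 121 012 021 122) $
         henceNear 101 221 (earlier 6 (reflect ∷ rotate ∷ reflect ∷ swap ∷ [])) $
         henceNear 012 101 (hexagon 012 111 221 101 110 222) $
         henceNear 021 101 (hexagon 011 022 101 012 221 021) $
         henceFar 001 110 (earlier 6 (reflect ∷ rotate ∷ reflect ∷ rotate ∷ reflect ∷ [])) $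
         henceFar 001 211 (hexagon 001 012 021 110 011 211) $
         henceFar 001 121 (hexagon 001 012 122 110 011 121) $
         henceNear 000 012 (earlier 7 (reflect ∷ swap ∷ reflect ∷ rotate ∷ reflect ∷ [])) $
         henceFar 000 021 (earlier 4 (rotate ∷ reflect ∷ swap ∷ [])) $
         hexagon 000 121 011 021 001 012)
  ∷ (far 011 212 ∷ near 110 212 ∷ near 121 212 ∷ near 010 121 ∷ []
      by henceNear 010 211 (hexagon 010 212 111 211 011 121) $
         henceFar 121 210 (earlier 6 (swap ∷ rotate ∷ reflect ∷ [])) $
         hexagon 010 210 212 110 121 211)
  ∷ (near 011 122 ∷ near 012 211 ∷ near 012 121 ∷ near 121 212 ∷ near 011 212 ∷ []
      by henceNear 110 212 (earlier 6 (reflect ∷ [])) $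
         henceNear 022 212 (hexagon 011 022 121 012 212 122) $
         henceNear 012 110 (earlier 6 []) $
         henceFar 122 211 (hexagon 011 121 211 012 122 212) $
         henceFar 011 221 (earlier 8 []) $
         henceNear 012 222 (earlier 7 []) $
         henceNear 111 222 (hexagon 011 211 222 221 122 111) $
         henceNear 110 122 (hexagon 012 122 212 022 110 222) $
         henceNear 021 110 (hexagon 011 110 121 012 021 122) $
         henceFar 110 221 (hexagon 011 110 211 221 111 122) $
         henceNear 121 210 (hexagon 110 121 211 221 210 212) $
         henceNear 210 222 (hexagon 110 211 222 221 122 210) $
         henceFar 021 222 (hexagon 021 212 221 121 222 110) $
         henceFar 011 210 (hexagon 011 110 121 012 210 122) $
         hexagon 011 121 222 210 111 021)
  ∷ (near 011 212 ∷ near 111 222 ∷ near 012 222 ∷ near 012 121 ∷ near 121 212 ∷ []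
      by henceNear 012 211 (hexagon 012 111 212 211 121 222) $
         henceFar 011 122 (earlier 10 []) $
         henceNear 022 212 (earlier 7 (reflect ∷ [])) $
         henceNear 022 111 (hexagon 011 022 112 122 111 212) $
         hexagon 012 111 212 022 121 222)
  ∷ (near 110 212 ∷ far 122 211 ∷ near 012 211 ∷ near 012 121 ∷ []
      by henceNear 012 222 (earlier 7 []) $
         henceNear 121 212 (hexagon 012 122 212 112 211 121) $
         henceNear 111 222 (hexagon 012 111 122 112 222 211) $
         henceFar 011 212 (earlier 11 []) $
         henceNear 012 110 (earlier 5 []) $
         henceFar 010 121 (earlier 9 []) $
         henceNear 021 110 (hexagon 010 012 021 121 011 110) $
         henceNear 021 211 (hexagon 011 110 211 212 111 021) $
         henceNear 021 112 (hexagon 011 110 112 212 111 021) $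
         hexagon 012 021 122 112 121 211)
  ∷ (far 010 121 ∷ far 110 212 ∷ near 012 121 ∷ near 121 212 ∷ far 122 211 ∷ []
      by henceFar 011 212 (earlier 6 (reflect ∷ [])) $
         henceNear 012 211 (hexagon 011 121 211 212 111 012) $
         henceNear 012 222 (earlier 7 []) $
         henceNear 012 110 (earlier 5 []) $
         henceNear 111 222 (earlier 3 (reflect ∷ swap ∷ rotate ∷ reflect ∷ [])) $
         henceFar 110 122 (hexagon 012 122 212 112 211 110) $
         henceNear 021 110 (hexagon 010 012 021 121 011 110) $
         henceFar 021 112 (hexagon 012 021 212 112 121 110) $
         henceNear 022 111 (hexagon 021 111 122 112 022 110) $
         henceNear 021 222 (hexagon 012 021 122 022 222 110) $
         henceFar 022 212 (hexagon 011 022 121 212 012 111) $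
         henceFar 021 211 (hexagon 021 122 212 112 211 022) $
         henceFar 110 221 (hexagon 021 212 221 211 110 222) $
         henceNear 210 222 (hexagon 021 210 212 211 222 110) $
         henceNear 121 210 (hexagon 021 210 221 211 121 110) $
         henceNear 112 210 (hexagon 111 210 212 121 112 222) $
         henceFar 011 210 (hexagon 010 012 210 121 011 110) $
         earlier 5 (swap ∷ rotate ∷ []))
  ∷ (far 122 211 ∷ near 012 211 ∷ near 012 121 ∷ []
      by henceNear 121 212 (hexagon 012 122 212 112 211 121) $
         henceFar 110 212 (earlier 12 []) $
         henceNear 012 110 (earlier 6 []) $
         henceFar 011 212 (earlier 6 (reflect ∷ [])) $
         henceNear 010 121 (earlier 13 []) $
         henceNear 010 112 (hexagon 010 212 111 112 011 121) $
         henceFar 021 112 (earlier 10 (reflect ∷ swap ∷ rotate ∷ reflect ∷ [])) $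
         earlier 12 (reflect ∷ swap ∷ rotate ∷ []))
  ∷ (near 021 211 ∷ near 122 211 ∷ near 021 110 ∷ far 021 112 ∷ []
      by henceNear 120 211 (earlier 14 (rotate ∷ reflect ∷ swap ∷ [])) $
         henceNear 011 122 (hexagon 011 112 211 122 021 111) $
         henceNear 110 122 (hexagon 021 122 111 112 110 211) $
         henceNear 110 221 (earlier 14 (rotate ∷ reflect ∷ [])) $
         henceNear 101 122 (earlier 6 (rotate ∷ reflect ∷ [])) $
         henceNear 021 101 (earlier 6 (rotate ∷ reflect ∷ swap ∷ [])) $
         henceFar 011 221 (earlier 10 (reflect ∷ rotate ∷ reflect ∷ swap ∷ [])) $
         henceNear 101 212 (earlier 14 (swap ∷ reflect ∷ [])) $
         henceNear 121 212 (hexagon 021 212 111 112 121 101) $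
         henceNear 011 212 (hexagon 011 101 112 212 111 021) $
         henceFar 011 120 (hexagon 011 121 211 221 120 212) $
         hexagon 011 121 211 120 122 212)
  ∷ (far 110 212 ∷ near 121 212 ∷ near 012 121 ∷ []
      by henceFar 011 212 (earlier 6 (reflect ∷ [])) $
         henceNear 012 211 (hexagon 011 121 211 212 111 012) $
         henceNear 122 211 (earlier 14 []) $
         henceNear 012 110 (earlier 6 []) $
         henceNear 021 110 (earlier 14 (reflect ∷ swap ∷ rotate ∷ reflect ∷ [])) $
         henceFar 021 112 (hexagon 012 021 212 112 121 110) $
         henceFar 021 211 (earlier 15 []) $
         henceFar 011 122 (hexagon 011 121 211 012 122 021) $
         henceNear 110 122 (hexagon 012 021 122 022 211 110) $
         hexagon 011 110 112 122 111 021)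
  ∷ (near 121 212 ∷ near 012 121 ∷ []
      by henceNear 110 212 (earlier 16 []) $
         henceNear 012 110 (earlier 16 (reflect ∷ [])) $
         henceNear 110 221 (earlier 14 (swap ∷ rotate ∷ reflect ∷ [])) $
         henceNear 021 110 (earlier 14 (reflect ∷ swap ∷ rotate ∷ reflect ∷ [])) $
         henceNear 021 101 (earlier 16 (reflect ∷ rotate ∷ reflect ∷ swap ∷ [])) $
         henceNear 101 221 (earlier 16 (rotate ∷ reflect ∷ swap ∷ [])) $
         henceNear 010 101 (earlier 14 (reflect ∷ rotate ∷ reflect ∷ rotate ∷ reflect ∷ [])) $
         henceNear 101 210 (earlier 14 (rotate ∷ reflect ∷ rotate ∷ reflect ∷ [])) $
         henceNear 112 210 (earlier 16 (rotate ∷ reflect ∷ rotate ∷ reflect ∷ rotate ∷ [])) $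
         henceNear 010 112 (earlier 16 (reflect ∷ rotate ∷ reflect ∷ rotate ∷ reflect ∷ rotate ∷ [])) $
         henceFar 121 210 (earlier 10 (swap ∷ rotate ∷ [])) $
         henceFar 010 121 (earlier 10 (reflect ∷ swap ∷ rotate ∷ [])) $
         henceNear 112 221 (hexagon 010 221 111 121 112 101) $
         earlier 15 (rotate ∷ []))
  ∷ (near 012 110 ∷ near 012 121 ∷ []
      by henceFar 010 121 (earlier 17 (reflect ∷ swap ∷ rotate ∷ [])) $
         henceNear 021 110 (earlier 14 (reflect ∷ swap ∷ rotate ∷ reflect ∷ [])) $
         henceFar 001 110 (earlier 17 (reflect ∷ rotate ∷ reflect ∷ rotate ∷ [])) $
         henceFar 001 121 (hexagon 001 010 012 110 121 011) $
         henceFar 012 101 (earlier 14 (reflect ∷ swap ∷ reflect ∷ rotate ∷ reflect ∷ [])) $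
         henceNear 002 111 (hexagon 001 012 111 121 101 002) $
         henceNear 002 100 (hexagon 001 012 100 110 101 002) $
         henceNear 011 100 (hexagon 001 012 100 110 101 011) $
         henceFar 100 121 (hexagon 010 012 100 121 011 110) $
         henceFar 011 120 (earlier 17 (reflect ∷ rotate ∷ reflect ∷ swap ∷ rotate ∷ [])) $
         henceNear 002 021 (hexagon 002 011 121 021 111 100) $
         henceNear 020 111 (hexagon 010 111 120 121 020 011) $
         henceFar 002 120 (hexagon 002 011 121 012 120 100) $
         hexagon 002 020 110 120 021 111)
  -- The goal of all patterns above: the midpoint of an edge of the cube and the centre of a face,
  -- differing by one in every coordinate. The symmetries act transitively on the 24 such pairs, so
  -- none of them can be short.
  ∷ (near 012 121 ∷ []
      by henceFar 010 121 (earlier 17 (reflect ∷ swap ∷ rotate ∷ [])) $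
         henceFar 121 212 (earlier 17 []) $
         henceFar 012 110 (earlier 18 []) $
         henceFar 012 211 (earlier 18 (reflect ∷ swap ∷ rotate ∷ reflect ∷ [])) $
         henceNear 011 120 (hexagon 010 012 120 121 110 011) $
         henceNear 112 221 (hexagon 012 212 221 211 121 112) $
         henceFar 011 100 (earlier 17 (reflect ∷ rotate ∷ reflect ∷ swap ∷ rotate ∷ [])) $
         henceFar 101 120 (earlier 18 (reflect ∷ rotate ∷ [])) $
         henceFar 112 120 (earlier 18 (reflect ∷ rotate ∷ reflect ∷ swap ∷ rotate ∷ reflect ∷ [])) $
         henceFar 110 221 (hexagon 012 120 221 110 112 121) $
         henceFar 112 201 (earlier 17 (rotate ∷ rotate ∷ [])) $
         henceFar 010 112 (hexagon 010 221 111 121 110 112) $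
         henceFar 011 221 (earlier 18 (rotate ∷ rotate ∷ reflect ∷ [])) $
         henceFar 101 221 (earlier 18 (reflect ∷ rotate ∷ swap ∷ [])) $
         henceNear 001 110 (hexagon 001 100 120 110 011 101) $
         henceFar 121 201 (hexagon 012 201 111 211 112 121) $
         henceNear 102 211 (hexagon 101 112 211 221 201 102) $
         henceFar 001 112 (hexagon 001 010 012 011 112 110) $
         henceFar 012 101 (hexagon 012 201 221 211 121 101) $
         henceFar 011 102 (hexagon 011 112 211 221 102 012) $
         hexagon 001 012 102 112 101 011)
  ∷ []

conclusion : Refutation
conclusion =
  henceFar 011 100 (earlier 19 (reflect ∷ rotate ∷ reflect ∷ swap ∷ rotate ∷ [])) $
  henceFar 011 120 (earlier 19 (reflect ∷ rotate ∷ [])) $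
  henceFar 010 121 (earlier 19 (reflect ∷ swap ∷ rotate ∷ [])) $
  -- These six points form a 6-cycle in a unit subcube. Two of its diagonals, 010-121 and 011-120,
  -- have just been shown long, so the third one cannot be long as well.
  henceNear 021 110 (hexagon 010 021 120 121 110 011) $
  henceFar 001 110 (earlier 17 (reflect ∷ rotate ∷ reflect ∷ rotate ∷ [])) $
  henceFar 021 101 (earlier 18 (rotate ∷ reflect ∷ swap ∷ [])) $
  hexagon 001 021 100 110 101 011

noConfiguration : ¬ Configuration
-- Each `tt` has type `T` of a closed boolean, which the type checker evaluates: this is where the
-- certificate is run.
noConfiguration C = refutes-sound (valid-sound [] lemmas [] tt) [] conclusion tt C []

-- From real to rational distances

-- The double negation lets finitely many undecidable comparisons of reals be
-- settled at once.
Eventually : (ℕ → Set) → Set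
Eventually P = ¬ ¬ ∃ λ N → ∀ n → N ℕ.≤ n → P n

module _ {P Q : ℕ → Set} where
  ev-map : (∀ n → P n → Q n) → Eventually P → Eventually Q
  ev-map f p k = p λ (N , h) → k (N , λ n N≤n → f n (h n N≤n))

  ev-zip : {R : ℕ → Set} → (∀ n → P n → Q n → R n) →
    Eventually P → Eventually Q → Eventually R
  ev-zip f p q k = p λ (M , g) → q λ (N , h) →
    k (M ℕ.⊔ N , λ n ≤n → f n (g n (ℕ.m⊔n≤o⇒m≤o M N ≤n)) (h n (ℕ.m⊔n≤o⇒n≤o M N ≤n)))

always : ∀ {P : ℕ → Set} → (∀ n → P n) → Eventually P
always p k = k (0 , λ n _ → p n)

-- Finiteness is essential here: the double negations are discharged one by one, and the thresholds
-- are combined by maxima.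
ev-∀ : ∀ {k} {P : ℕ → Fin k → Set} → (∀ i → Eventually λ n → P n i) → Eventually λ n → ∀ i → P n i
ev-∀ {zero}  p = always λ _ ()
ev-∀ {suc k} p = ev-zip (λ _ h hs → λ { zero → h ; (suc i) → hs i })
  (p zero) (ev-∀ (λ i → p (suc i)))

ev-∀-Point : {P : ℕ → Point → Set} → (∀ p → Eventually λ n → P n p) → Eventually λ n → ∀ p → P n p
ev-∀-Point h = ev-map (λ { _ f ⟨ x , y , z ⟩ → f x y z })
  (ev-∀ λ x → ev-∀ λ y → ev-∀ λ z → h ⟨ x , y , z ⟩)

infix 4 _≲_ _≪_

-- The order of limits, stated for bare sequences so that approximate path lengths need not be
-- packaged as reals. Being a record keeps `f` and `g` inferable.
record _≲_ (f g : ℕ → ℚ) : Set where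
  constructor within
  field
    bound : ∀ δ → 0ℚ ℚ.< δ → Eventually λ n → f n ℚ.< g n ℚ.+ δ

open _≲_

_≪_ : (ℕ → ℚ) → (ℕ → ℚ) → Set
f ≪ g = Eventually λ n → f n ℚ.< g n

private
  add-pos : ∀ p δ → 0ℚ ℚ.< δ → p ℚ.< p ℚ.+ δ
  add-pos p δ 0<δ = subst (ℚ._< p ℚ.+ δ) (+-identityʳ p) (+-monoʳ-< p 0<δ)

  halve : ∀ δ → ½ ℚ.* δ ℚ.+ ½ ℚ.* δ ≡ δ
  halve δ = trans (sym (*-distribʳ-+ δ ½ ½)) (*-identityˡ δ)

  scale-pos : ∀ p .{{_ : Positive p}} δ → 0ℚ ℚ.< δ → 0ℚ ℚ.< p ℚ.* δ
  scale-pos p δ 0<δ = subst (ℚ._< p ℚ.* δ) (*-zeroʳ p) (*-monoʳ-<-pos p 0<δ)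

≤⇒≲ : ∀ {f g : ℕ → ℚ} → (∀ n → f n ℚ.≤ g n) → f ≲ g
≤⇒≲ {f} {g} f≤g = within λ δ 0<δ → always λ n → ≤-<-trans (f≤g n) (add-pos (g n) δ 0<δ)

≲-trans : ∀ {f g h} → f ≲ g → g ≲ h → f ≲ h
≲-trans {f} {g} {h} f≲g g≲h = within λ δ 0<δ → ev-zip (combine δ)
  (bound f≲g (½ ℚ.* δ) (scale-pos ½ δ 0<δ)) (bound g≲h (½ ℚ.* δ) (scale-pos ½ δ 0<δ))
  where
  open ≤-Reasoning
  combine : ∀ δ n → f n ℚ.< g n ℚ.+ ½ ℚ.* δ → g n ℚ.< h n ℚ.+ ½ ℚ.* δ → f n ℚ.< h n ℚ.+ δ
  combine δ n f< g< = begin-strict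
    f n                           <⟨ f< ⟩
    g n ℚ.+ ½ ℚ.* δ               <⟨ +-monoˡ-< (½ ℚ.* δ) g< ⟩
    (h n ℚ.+ ½ ℚ.* δ) ℚ.+ ½ ℚ.* δ ≡⟨ +-assoc (h n) (½ ℚ.* δ) (½ ℚ.* δ) ⟩
    h n ℚ.+ (½ ℚ.* δ ℚ.+ ½ ℚ.* δ) ≡⟨ cong (h n ℚ.+_) (halve δ) ⟩
    h n ℚ.+ δ ∎

private
  interchange : ∀ a b c d → (a ℚ.+ b) ℚ.+ (c ℚ.+ d) ≡ (a ℚ.+ c) ℚ.+ (b ℚ.+ d)
  interchange = solve 4 (λ a b c d → (a :+ b) :+ (c :+ d) := (a :+ c) :+ (b :+ d)) refl
    where open +-*-Solver

≲-+ : ∀ {f g f′ g′} → f ≲ g → f′ ≲ g′ → (λ n → f n ℚ.+ f′ n) ≲ (λ n → g n ℚ.+ g′ n)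
≲-+ {f} {g} {f′} {g′} f≲g f′≲g′ = within λ δ 0<δ → ev-zip (combine δ)
  (bound f≲g (½ ℚ.* δ) (scale-pos ½ δ 0<δ)) (bound f′≲g′ (½ ℚ.* δ) (scale-pos ½ δ 0<δ))
  where
  open ≤-Reasoning
  combine : ∀ δ n → f n ℚ.< g n ℚ.+ ½ ℚ.* δ → f′ n ℚ.< g′ n ℚ.+ ½ ℚ.* δ →
    f n ℚ.+ f′ n ℚ.< (g n ℚ.+ g′ n) ℚ.+ δ
  combine δ n f< f′< = begin-strict
    f n ℚ.+ f′ n                             <⟨ +-mono-< f< f′< ⟩
    (g n ℚ.+ ½ ℚ.* δ) ℚ.+ (g′ n ℚ.+ ½ ℚ.* δ) ≡⟨ interchange (g n) (½ ℚ.* δ) (g′ n) (½ ℚ.* δ) ⟩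
    (g n ℚ.+ g′ n) ℚ.+ (½ ℚ.* δ ℚ.+ ½ ℚ.* δ) ≡⟨ cong (g n ℚ.+ g′ n ℚ.+_) (halve δ) ⟩
    (g n ℚ.+ g′ n) ℚ.+ δ ∎

private
  p≤∣p∣ : ∀ p → p ℚ.≤ ℚ.∣ p ∣
  p≤∣p∣ p with ≤-total 0ℚ p
  ... | inj₁ 0≤p = ≤-reflexive (sym (0≤p⇒∣p∣≡p 0≤p))
  ... | inj₂ p≤0 = ≤-trans p≤0 (0≤∣p∣ p)

  +-cancelʳ-< : ∀ r p q → p ℚ.+ r ℚ.< q ℚ.+ r → p ℚ.< q
  +-cancelʳ-< r p q pr<qr = ≰⇒> λ q≤p → ≤⇒≯ (+-monoˡ-≤ r q≤p) pr<qr

  near-tail : ∀ p q {η} → ℚ.∣ p ℚ.- q ∣ ℚ.< η → p ℚ.< q ℚ.+ η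
  near-tail p q {η} pq<η = begin-strict
    p                   ≡⟨ solve 2 (λ p q → p := q :+ (p :- q)) refl p q ⟩
    q ℚ.+ (p ℚ.- q)     ≤⟨ +-monoʳ-≤ q (p≤∣p∣ (p ℚ.- q)) ⟩
    q ℚ.+ ℚ.∣ p ℚ.- q ∣ <⟨ +-monoʳ-< q pq<η ⟩
    q ℚ.+ η ∎
    where
    open ≤-Reasoning
    open +-*-Solver

⅕ : ℚ
⅕ = ℤ.+ 1 ℚ./ 5

private
  five-fifths : ∀ y δ → let η = ⅕ ℚ.* δ in ((y ℚ.+ η) ℚ.+ (η ℚ.+ (η ℚ.+ η))) ℚ.+ η ≡ y ℚ.+ δ
  five-fifths = solve 2 (λ y δ → let η = con ⅕ :* δ in
    ((y :+ η) :+ (η :+ (η :+ η))) :+ η := y :+ δ) refl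
    where open +-*-Solver

  regroup : ∀ y η → ((y ℚ.+ η) ℚ.+ η) ℚ.+ (η ℚ.+ η) ≡ (y ℚ.+ (η ℚ.+ (η ℚ.+ η))) ℚ.+ η
  regroup = solve 2 (λ y η →
    ((y :+ η) :+ η) :+ (η :+ η) := (y :+ (η :+ (η :+ η))) :+ η) refl
    where open +-*-Solver

-- With both sequences within η = δ/5 of their values at N, comparing those two
-- values with a margin of 3η decides which of the cases holds.
ℝ≤⇒≲ : ∀ x y → x ℝ.≤ y → seq x ≲ seq y
ℝ≤⇒≲ x y x≤y = within λ δ 0<δ → compare δ (scale-pos ⅕ δ 0<δ)
  where
  open ≤-Reasoning
  compare : ∀ δ → 0ℚ ℚ.< ⅕ ℚ.* δ → Eventually λ n → seq x n ℚ.< seq y n ℚ.+ δ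
  compare δ 0<η k with ℝ.cauchy x (⅕ ℚ.* δ) 0<η | ℝ.cauchy y (⅕ ℚ.* δ) 0<η
  ... | M , cx | M′ , cy = conclude
    where
    η : ℚ
    η = ⅕ ℚ.* δ

    N : ℕ
    N = M ℕ.⊔ M′

    module _ n (N≤n : N ℕ.≤ n) where
      x-above : seq x n ℚ.< seq x N ℚ.+ η
      x-above = near-tail (seq x n) (seq x N) (cx n N (ℕ.m⊔n≤o⇒m≤o M M′ N≤n) (ℕ.m≤m⊔n M M′))
      x-below : seq x N ℚ.< seq x n ℚ.+ η
      x-below = near-tail (seq x N) (seq x n) (cx N n (ℕ.m≤m⊔n M M′) (ℕ.m⊔n≤o⇒m≤o M M′ N≤n))
      y-above : seq y n ℚ.< seq y N ℚ.+ η
      y-above = near-tail (seq y n) (seq y N) (cy n N (ℕ.m⊔n≤o⇒n≤o M M′ N≤n) (ℕ.m≤n⊔m M M′))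
      y-below : seq y N ℚ.< seq y n ℚ.+ η
      y-below = near-tail (seq y N) (seq y n) (cy N n (ℕ.m≤n⊔m M M′) (ℕ.m⊔n≤o⇒n≤o M M′ N≤n))

      y-step : (seq y N ℚ.+ (η ℚ.+ (η ℚ.+ η))) ℚ.+ η ℚ.< ((seq y n ℚ.+ η) ℚ.+ (η ℚ.+ (η ℚ.+ η))) ℚ.+ η
      y-step = +-monoˡ-< η (+-monoˡ-< (η ℚ.+ (η ℚ.+ η)) y-below)

    conclude : ⊥
    -- Below the margin, two tail errors give 3η + 2η = δ. At or above it they leave 3η - 2η = η, a
    -- uniform gap that contradicts `x≤y`.
    conclude with seq x N <? seq y N ℚ.+ (η ℚ.+ (η ℚ.+ η))
    ... | yes x<y+3η = k (N , λ n N≤n → begin-strict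
      seq x n                                       <⟨ x-above n N≤n ⟩
      seq x N ℚ.+ η                                 <⟨ +-monoˡ-< η x<y+3η ⟩
      (seq y N ℚ.+ (η ℚ.+ (η ℚ.+ η))) ℚ.+ η         <⟨ y-step n N≤n ⟩
      ((seq y n ℚ.+ η) ℚ.+ (η ℚ.+ (η ℚ.+ η))) ℚ.+ η ≡⟨ five-fifths (seq y n) δ ⟩
      seq y n ℚ.+ δ ∎)
    ... | no x≮y+3η = x≤y (η , 0<η , N , λ n N≤n → <⇒≤ (+-cancelʳ-< (η ℚ.+ η) _ _ (begin-strict
      (seq y n ℚ.+ η) ℚ.+ (η ℚ.+ η)         <⟨ +-monoˡ-< (η ℚ.+ η) (+-monoˡ-< η (y-above n N≤n)) ⟩
      ((seq y N ℚ.+ η) ℚ.+ η) ℚ.+ (η ℚ.+ η) ≡⟨ regroup (seq y N) η ⟩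
      (seq y N ℚ.+ (η ℚ.+ (η ℚ.+ η))) ℚ.+ η ≤⟨ +-monoˡ-≤ η (≮⇒≥ x≮y+3η) ⟩
      seq x N ℚ.+ η                         <⟨ +-monoˡ-< η (x-below n N≤n) ⟩
      (seq x n ℚ.+ η) ℚ.+ η                 ≡⟨ +-assoc (seq x n) η η ⟩
      seq x n ℚ.+ (η ℚ.+ η) ∎)))

-- Doubling turns the gap δ between `x` and `y` into 2δ, which pays for a slack of δ at either end.
<-≪ : ∀ x y {f g} → x ℝ.< y →
  f ≲ (λ n → seq x n ℚ.+ seq x n) → (λ n → seq y n ℚ.+ seq y n) ≲ g → f ≪ g
<-≪ x y {f} {g} (δ , 0<δ , N , x+δ≤y) f≲2x 2y≲g =
  ev-zip (λ n x+δ≤y (f< , y<) → combine n x+δ≤y f< y<)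
    (λ k → k (N , x+δ≤y)) (ev-zip (λ _ → _,_) (bound f≲2x δ 0<δ) (bound 2y≲g δ 0<δ))
  where
  open ≤-Reasoning
  combine : ∀ n → seq x n ℚ.+ δ ℚ.≤ seq y n →
    f n ℚ.< (seq x n ℚ.+ seq x n) ℚ.+ δ → seq y n ℚ.+ seq y n ℚ.< g n ℚ.+ δ → f n ℚ.< g n
  combine n x+δ≤y f< y< = +-cancelʳ-< δ _ _ (begin-strict
    f n ℚ.+ δ                           <⟨ +-monoˡ-< δ f< ⟩
    ((seq x n ℚ.+ seq x n) ℚ.+ δ) ℚ.+ δ ≡⟨ +-assoc (seq x n ℚ.+ seq x n) δ δ ⟩
    (seq x n ℚ.+ seq x n) ℚ.+ (δ ℚ.+ δ) ≡⟨ interchange (seq x n) (seq x n) δ δ ⟩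
    (seq x n ℚ.+ δ) ℚ.+ (seq x n ℚ.+ δ) ≤⟨ +-mono-≤ x+δ≤y x+δ≤y ⟩
    seq y n ℚ.+ seq y n                 <⟨ y< ⟩
    g n ℚ.+ δ ∎)

∣∣≲ : ∀ x → ℝ.0ℝ ℝ.< x → (λ n → ℚ.∣ seq x n ∣) ≲ seq x
∣∣≲ x (δ , 0<δ , N , δ≤x) = within λ η 0<η k → k (N , λ n N≤n →
  ≤-<-trans (≤-reflexive (0≤p⇒∣p∣≡p (0≤x n N≤n))) (add-pos (seq x n) η 0<η))
  where
  0≤x : ∀ n → N ℕ.≤ n → 0ℚ ℚ.≤ seq x n
  0≤x n N≤n = ≤-trans (<⇒≤ (add-pos 0ℚ δ 0<δ)) (δ≤x n N≤n)

-- Adding the absolute values of the two weights of an edge gives a symmetric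
-- nonnegative weight for each n, so the four-point condition holds at each n
-- exactly; it approximates twice the given weight.
module Approximation (T : WeightedTree) where
  open WeightedTree T

  weightₙ : ℕ → ∀ x y → .(x ~ y) → ℚ
  weightₙ n x y e = ℚ.∣ seq (weight x y e) n ∣ ℚ.+ ℚ.∣ seq (weight y x (~-sym e)) n ∣

  module _ (n : ℕ) where
    open TreeMetric graph isTree (weightₙ n)
      (λ {x} {y} e → +-comm ℚ.∣ seq (weight x y e) n ∣ _)
      (λ x y e → +-mono-≤ (0≤∣p∣ (seq (weight x y e) n)) (0≤∣p∣ (seq (weight y x (~-sym e)) n)))
      public using () renaming (len to lenₙ; dist to distₙ; dist-sym to distₙ-sym; fourPoint to fourPointₙ)

  twice : ℝ → ℕ → ℚ
  twice x n = seq x n ℚ.+ seq x n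

  weight-≲ : ∀ {x y} (e : x ~ y) → (λ n → weightₙ n x y e) ≲ twice (weight x y e)
  weight-≲ {x} {y} e = ≲-+ (∣∣≲ (weight x y e) (weight-pos e))
    (≲-trans (∣∣≲ (weight y x (~-sym e)) (weight-pos (~-sym e)))
      (ℝ≤⇒≲ (weight y x (~-sym e)) (weight x y e) (proj₂ (weight-sym e))))

  ≲-weight : ∀ {x y} (e : x ~ y) → twice (weight x y e) ≲ (λ n → weightₙ n x y e)
  ≲-weight {x} {y} e = ≲-+ (≤⇒≲ λ n → p≤∣p∣ (seq (weight x y e) n))
    (≲-trans (ℝ≤⇒≲ (weight x y e) (weight y x (~-sym e)) (proj₁ (weight-sym e)))
      (≤⇒≲ λ n → p≤∣p∣ (seq (weight y x (~-sym e)) n)))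

  len-≲ : ∀ {x y} (p : Walk x y) → (λ n → lenₙ n p) ≲ twice (walkWeight p)
  len-≲ ε       = ≤⇒≲ λ _ → ≤-refl
  len-≲ (_◅_ {x} {y} e p) = ≲-trans (≲-+ (weight-≲ e) (len-≲ p))
    (≤⇒≲ λ n → ≤-reflexive (interchange (seq (weight x y e) n) _ (seq (walkWeight p) n) _))

  ≲-len : ∀ {x y} (p : Walk x y) → twice (walkWeight p) ≲ (λ n → lenₙ n p)
  ≲-len ε       = ≤⇒≲ λ _ → ≤-refl
  ≲-len (_◅_ {x} {y} e p) = ≲-trans
    (≤⇒≲ λ n → ≤-reflexive (interchange (seq (weight x y e) n) (seq (walkWeight p) n) _ _))
    (≲-+ (≲-weight e) (≲-len p))

-- From a PCG containing the cube to a configuration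

module _ {G : Graph} (P : PCG G)
  (embed   : Point → Graph.Vertex G)
  (edge    : ∀ p q → gap p q ≡ 1 → Graph._~_ G (embed p) (embed q))
  (nonedge : ∀ p q → 2 ℕ.≤ gap p q → ¬ Graph._~_ G (embed p) (embed q))
  (apart   : ∀ p q → 2 ℕ.≤ gap p q → embed p ≢ embed q)
  where

  open Graph G
  open PCG P
  open Approximation tree

  private
    leaf : Point → WeightedTree.Vertex tree
    leaf p = proj₁ (Bijection.to ζ (embed p))

    D : ℕ → Point → Point → ℚ
    D n p q = distₙ n (leaf p) (leaf q)

    distanceᵖ : Point → Point → ℝ
    distanceᵖ p q = distance (embed p) (embed q)

    D-≲ : ∀ p q → (λ n → D n p q) ≲ twice (distanceᵖ p q)
    D-≲ p q = len-≲ (WeightedTree.path tree (leaf p) (leaf q))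

    ≲-D : ∀ p q → twice (distanceᵖ p q) ≲ (λ n → D n p q)
    ≲-D p q = ≲-len (WeightedTree.path tree (leaf p) (leaf q))

    inBounds : ∀ p q → gap p q ≡ 1 → dmin ℝ.≤ distanceᵖ p q × distanceᵖ p q ℝ.≤ dmax
    inBounds p q g = Equivalence.to (compatible (embed p) (embed q) distinct) p~q
      where
      p~q : embed p ~ embed q
      p~q = edge p q g
      distinct : embed p ≢ embed q
      distinct eq = ~-irrefl (subst (embed p ~_) (sym eq) p~q)

    -- Real `≤` is by definition the negation of `<`, so refuting both alternatives places the
    -- distance within the bounds and makes the pair an edge.
    outOfBounds : ∀ p q → 2 ℕ.≤ gap p q →
      ¬ ¬ (distanceᵖ p q ℝ.< dmin ⊎ dmax ℝ.< distanceᵖ p q)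
    outOfBounds p q g k = nonedge p q g (Equivalence.from
      (compatible (embed p) (embed q) (apart p q g)) ((λ h → k (inj₁ h)) , (λ h → k (inj₂ h))))

    BelowEdges AboveEdges : ℕ → Point → Point → Set
    BelowEdges n p q = ∀ r s → gap r s ≡ 1 → D n p q ℚ.< D n r s
    AboveEdges n p q = ∀ r s → gap r s ≡ 1 → D n r s ℚ.< D n p q

    for-edges : {P : ℕ → Point → Point → Set} →
      (∀ r s → gap r s ≡ 1 → Eventually λ n → P n r s) →
      Eventually λ n → ∀ r s → gap r s ≡ 1 → P n r s
    for-edges h = ev-∀-Point λ r → ev-∀-Point λ s → at r s
      where
      at : ∀ r s → Eventually λ n → gap r s ≡ 1 → _
      at r s with gap r s ℕ.≟ 1
      ... | yes g = ev-map (λ _ p _ → p) (h r s g)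
      ... | no ¬g = always λ _ g → ⊥-elim (¬g g)

    separated : ∀ p q → Eventually λ n → 2 ℕ.≤ gap p q → BelowEdges n p q ⊎ AboveEdges n p q
    separated p q with 2 ℕ.≤? gap p q
    ... | no ¬g = always λ _ g → ⊥-elim (¬g g)
    ... | yes g = λ k → outOfBounds p q g λ
      { (inj₁ <dmin) → ev-map (λ _ below _ → inj₁ below) (for-edges λ r s e →
          <-≪ (distanceᵖ p q) dmin <dmin (D-≲ p q)
            (≲-trans (twice-mono dmin (distanceᵖ r s) (proj₁ (inBounds r s e))) (≲-D r s))) k
      ; (inj₂ dmax<) → ev-map (λ _ above _ → inj₂ above) (for-edges λ r s e →
          <-≪ dmax (distanceᵖ p q) dmax<
            (≲-trans (D-≲ r s) (twice-mono (distanceᵖ r s) dmax (proj₂ (inBounds r s e)))) (≲-D p q)) k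
      }
      where
      twice-mono : ∀ x y → x ℝ.≤ y → twice x ≲ twice y
      twice-mono x y x≤y = ≲-+ (ℝ≤⇒≲ x y x≤y) (ℝ≤⇒≲ x y x≤y)

  containsCube⇒¬PCG : ⊥
  containsCube⇒¬PCG = ev-∀-Point (λ p → ev-∀-Point (separated p)) λ (N , separatedₙ) →
    noConfiguration record
      { D          = D N
      ; D-sym      = λ p q → distₙ-sym N (leaf p) (leaf q)
      ; fourPoint  = λ a b c d → fourPointₙ N (leaf a) (leaf b) (leaf c) (leaf d)
      -- `separated` has already compared nonedges with edges directly, so the values taken on edges
      -- at index `N` stand in for the interval from `dmin` to `dmax`.
      ; EdgeLength = λ e → ∃ λ p → ∃ λ q → gap p q ≡ 1 × e ≡ D N p q
      ; edge       = λ p q g → p , q , g , refl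
      ; nonedge    = λ p q g → Sum.map
          (λ below e → λ { (r , s , g , refl) → below r s g })
          (λ above e → λ { (r , s , g , refl) → above r s g })
          (separatedₙ N ℕ.≤-refl p q g)
      }

-- The cube inside a grid

-- Adjacency becomes the numerical condition `ℓ₁ u v ≡ 1`. An embedding that preserves this distance
-- thus yields edges, nonedges and distinctness at once.
ℓ₁ : ∀ {d} {ns : Vec ℕ d} → GridPoint ns → GridPoint ns → ℕ
ℓ₁ []      []      = 0
ℓ₁ (x ∷ u) (y ∷ v) = ∣ toℕ x - toℕ y ∣ ℕ.+ ℓ₁ u v

ℓ₁≡0⇒≡ : ∀ {d} {ns : Vec ℕ d} (u v : GridPoint ns) → ℓ₁ u v ≡ 0 → u ≡ v
ℓ₁≡0⇒≡ []      []      _  = refl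
ℓ₁≡0⇒≡ (x ∷ u) (y ∷ v) eq = cong₂ _∷_
  (Fin.toℕ-injective (ℕ.∣m-n∣≡0⇒m≡n (ℕ.m+n≡0⇒m≡0 _ eq)))
  (ℓ₁≡0⇒≡ u v (ℕ.m+n≡0⇒n≡0 ∣ toℕ x - toℕ y ∣ eq))

agree⇒ℓ₁≡0 : ∀ {d} {ns : Vec ℕ d} (u v : GridPoint ns) →
  (∀ j → coord u j ≡ coord v j) → ℓ₁ u v ≡ 0
agree⇒ℓ₁≡0 []      []      _     = refl
agree⇒ℓ₁≡0 (x ∷ u) (y ∷ v) agree =
  cong₂ ℕ._+_ (ℕ.m≡n⇒∣m-n∣≡0 (cong toℕ (agree zero))) (agree⇒ℓ₁≡0 u v (λ j → agree (suc j)))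

ℓ₁≡1⇒adjacent : ∀ {d} {ns : Vec ℕ d} (u v : GridPoint ns) → ℓ₁ u v ≡ 1 → GridAdj u v
ℓ₁≡1⇒adjacent []      []      ()
ℓ₁≡1⇒adjacent (x ∷ u) (y ∷ v) eq with ∣ toℕ x - toℕ y ∣ in xy
... | suc zero = zero , xy , λ
  { zero    0≢0 → ⊥-elim (0≢0 refl)
  ; (suc j) _   → cong (λ w → coord w j) (ℓ₁≡0⇒≡ u v (cong ℕ.pred eq)) }
... | zero with i , near , agree ← ℓ₁≡1⇒adjacent u v eq = suc i , near , λ
  { zero    _   → Fin.toℕ-injective (ℕ.∣m-n∣≡0⇒m≡n xy)
  ; (suc j) j≢i → agree j (λ j≡i → j≢i (cong suc j≡i)) }

adjacent⇒ℓ₁≡1 : ∀ {d} {ns : Vec ℕ d} (u v : GridPoint ns) → GridAdj u v → ℓ₁ u v ≡ 1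
adjacent⇒ℓ₁≡1 (x ∷ u) (y ∷ v) (zero , near , agree) =
  cong₂ ℕ._+_ near (agree⇒ℓ₁≡0 u v (λ j → agree (suc j) λ ()))
adjacent⇒ℓ₁≡1 (x ∷ u) (y ∷ v) (suc i , near , agree) =
  cong₂ ℕ._+_ (ℕ.m≡n⇒∣m-n∣≡0 (cong toℕ (agree zero λ ())))
    (adjacent⇒ℓ₁≡1 u v (i , near , λ j j≢i → agree (suc j) (λ sj≡si → j≢i (Fin.suc-injective sj≡si))))

-- m of the sides are chosen to be at least 3, the others are nonempty.
data Wide : ∀ {d} → Vec ℕ d → ℕ → Set where
  []   : Wide [] 0
  skip : ∀ {d n m} {ns : Vec ℕ d} → 1 ≤ n → Wide ns m → Wide (n ∷ ns) m
  keep : ∀ {d n m} {ns : Vec ℕ d} → 3 ≤ n → Wide ns m → Wide (n ∷ ns) (suc m)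

count⇒Wide : ∀ {d} (ns : Vec ℕ d) → (∀ i → 1 ≤ lookup ns i) →
  ∀ m → m ≤ count (3 ≤?_) ns → Wide ns m
count⇒Wide []       _      zero    _  = []
count⇒Wide (n ∷ ns) ns≥1 zero    _  = skip (ns≥1 zero) (count⇒Wide ns (λ i → ns≥1 (suc i)) zero ℕ.z≤n)
-- `2 <ᵇ n` is what the decision `3 ≤? n` computes to, so abstracting it also reduces the `count` in
-- the type of `m≤`.
count⇒Wide (n ∷ ns) ns≥1 (suc m) m≤ with 2 ℕ.<ᵇ n in 2<n
... | true  = keep (ℕ.≤ᵇ⇒≤ 3 n (subst T (sym 2<n) tt)) (count⇒Wide ns (λ i → ns≥1 (suc i)) m (ℕ.s≤s⁻¹ m≤))
... | false = skip (ns≥1 zero) (count⇒Wide ns (λ i → ns≥1 (suc i)) (suc m) m≤)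

place : ∀ {d m} {ns : Vec ℕ d} → Wide ns m → Vec (Fin 3) m → GridPoint ns
place []           []       = []
-- A side that is not chosen gets the constant coordinate 0, since `1 ≤ n` is `0 < n`; it
-- contributes nothing to `ℓ₁`.
place (skip 1≤n w) cs       = fromℕ< 1≤n ∷ place w cs
place (keep 3≤n w) (c ∷ cs) = inject≤ c 3≤n ∷ place w cs

distance₃ : ∀ {m} → Vec (Fin 3) m → Vec (Fin 3) m → ℕ
distance₃ []       []       = 0
distance₃ (b ∷ bs) (c ∷ cs) = ∣ toℕ b - toℕ c ∣ ℕ.+ distance₃ bs cs

ℓ₁-place : ∀ {d m} {ns : Vec ℕ d} (w : Wide ns m) bs cs →
  ℓ₁ (place w bs) (place w cs) ≡ distance₃ bs cs
ℓ₁-place []           []       []       = refl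
ℓ₁-place (skip 1≤n w) bs       cs       = cong₂ ℕ._+_ (ℕ.∣n-n∣≡0 (toℕ (fromℕ< 1≤n))) (ℓ₁-place w bs cs)
ℓ₁-place (keep 3≤n w) (b ∷ bs) (c ∷ cs) = cong₂ ℕ._+_
  (cong₂ ∣_-_∣ (Fin.toℕ-inject≤ b 3≤n) (Fin.toℕ-inject≤ c 3≤n)) (ℓ₁-place w bs cs)

coordinates : Point → Vec (Fin 3) 3
coordinates ⟨ x , y , z ⟩ = x ∷ y ∷ z ∷ []

distance₃-coordinates : ∀ p q → distance₃ (coordinates p) (coordinates q) ≡ gap p q
distance₃-coordinates ⟨ x , y , z ⟩ ⟨ x′ , y′ , z′ ⟩ =
  cong (λ t → ∣ toℕ x - toℕ x′ ∣ ℕ.+ (∣ toℕ y - toℕ y′ ∣ ℕ.+ t)) (ℕ.+-identityʳ ∣ toℕ z - toℕ z′ ∣)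

wide⇒¬PCG : ∀ {d} {ns : Vec ℕ d} → Wide ns 3 → ¬ PCG (Grid ns)
wide⇒¬PCG {ns = ns} w P = containsCube⇒¬PCG P embed
  (λ p q g → ℓ₁≡1⇒adjacent (embed p) (embed q) (trans (ℓ₁-embed p q) g))
  (λ p q g p~q → 2≤⇒≢1 g (trans (sym (ℓ₁-embed p q)) (adjacent⇒ℓ₁≡1 (embed p) (embed q) p~q)))
  (λ p q g p≡q → 2≤⇒≢0 g (trans (sym (ℓ₁-embed p q))
    (agree⇒ℓ₁≡0 (embed p) (embed q) (λ j → cong (λ u → coord u j) p≡q))))
  where
  embed : Point → GridPoint ns
  embed p = place w (coordinates p)

  ℓ₁-embed : ∀ p q → ℓ₁ (embed p) (embed q) ≡ gap p q
  ℓ₁-embed p q = trans (ℓ₁-place w (coordinates p) (coordinates q)) (distance₃-coordinates p q)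

  2≤⇒≢1 : ∀ {k} → 2 ≤ k → k ≢ 1
  2≤⇒≢1 (ℕ.s≤s (ℕ.s≤s _)) ()

  2≤⇒≢0 : ∀ {k} → 2 ≤ k → k ≢ 0
  2≤⇒≢0 (ℕ.s≤s _) ()

corollary5p5 : ((d : ℕ) → 1 ≤ d → (ns : Vec ℕ d) → ((i : Fin d) → 1 ≤ lookup ns i) →
    3 ≤ count (3 ≤?_) ns → ¬ PCG (Grid ns))
    × ((a b c : ℕ) → 3 ≤ a → 3 ≤ b → 3 ≤ c → ¬ PCG (Grid (a ∷ b ∷ c ∷ [])))
corollary5p5 =
  (λ d _ ns ns≥1 3≤count → wide⇒¬PCG (count⇒Wide ns ns≥1 3 3≤count)) ,
  (λ a b c 3≤a 3≤b 3≤c → wide⇒¬PCG (keep 3≤a (keep 3≤b (keep 3≤c []))))
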